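{- Let $Q=sat(u,l)$, where $u$ is a representation of a propositional formula in CNF and $l$ is the list of the variables in $u$, and let $T$ be a pruned SLD-tree with root $Q$ for the programs $\Pi_1,\ldots,\Pi_5$ (a partition of $P_3$) via a c-selection rule that implements the control described in the context. Then $T$ is complete with respect to $S_3^0$; that is, for every ground instance $Q\theta$ of $Q$, if $Q\theta\in S_3^0$ then $Q\theta$ is an instance of an answer of $T$.
   Context: A fixed alphabet of function and predicate symbols is assumed, containing at least those occurring below; $\mathcal{HU}$ is the Herbrand universe (all ground terms). Prolog list notation is used ($[\,]$ is a constant, $[h|t]$ a binary constructor); $-$ is a binary function symbol written infix; $\mathtt{true},\mathtt{false}$ are constants. Representation of CNF formulae: propositional variables are represented as logical variables; a positive literal $x$ is represented as the term $\mathtt{true}-X$, a negative literal $\neg x$ as $\mathtt{false}-X$; a clause is represented as the list of the representations of its literals, and a conjunction of clauses as the list of the representations of the clauses. The definite clause program $P_3$ consists of the following rules (names beginning with upper-case letters are variables): 1. $sat\_cnf([\,])$. 2. $sat\_cnf([C|Cs])\gets sat\_cl(C), sat\_cnf(Cs)$. 3. $sat\_cl([P-V|R])\gets sat\_cl3(R,V,P)$. 4. ${=}(X,X)$. 5. $sat\_cl3([\,],V,P)\gets V=P$. 6. $sat\_cl3([P_2-V_2|R],V_1,P_1)\gets sat\_cl5(V_1,P_1,V_2,P_2,R)$. 7. $sat\_cl5(V_1,P_1,V_2,P_2,R)\gets sat\_cl5a(V_1,P_1,V_2,P_2,R)$. 8. $sat\_cl5(V_1,P_1,V_2,P_2,R)\gets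 sat\_cl5a(V_2,P_2,V_1,P_1,R)$. 9. $sat\_cl5a(V_1,P_1,V_2,P_2,R)\gets V_1=P_1$. 10. $sat\_cl5a(V_1,P_1,V_2,P_2,R)\gets sat\_cl3(R,V_2,P_2)$. 11. $sat(Cs,Vs)\gets sat\_cnf(Cs), tflist(Vs)$. 12. $tflist([\,])$. 13. $tflist([V|Vs])\gets tflist(Vs), tf(V)$. 14. $tf(\mathtt{true})$. 15. $tf(\mathtt{false})$. Let $\Pi_1,\Pi_2,\Pi_3,\Pi_4$ be the one-rule programs consisting of rule 7, rule 8, rule 9, rule 10, respectively, and $\Pi_5=P_3\setminus(\Pi_1\cup\Pi_2\cup\Pi_3\cup\Pi_4)$. A c-selection rule is a function assigning to a (non-empty) query an atom in the query and one of the programs $\emptyset,\Pi_1,\ldots,\Pi_5$. A pruned SLD-tree (csSLD-tree) via a c-selection rule is constructed as an SLD-tree, but for each node its children are constructed by resolving the selected atom using only the rules of the program selected in that node. An answer of such a tree with root $Q$ is an instance $Q\theta$ of the root, where $\theta$ is the computed answer substitution of a successful derivation that is a branch of the tree. Control: call a $sat\_cl5$-atom delayed if its first and third arguments are both variables. In a query consisting solely of delayed atoms the program $\emptyset$ is selected (so the query is a leaf). In any other non-empty query a non-delayed atom $A$ is selected, together with: $\Pi_1$ if $A$ is a $sat\_cl5$-atom whose first argument is not a variable; $\Pi_2$ if $A$ is a $sat\_cl5$-atom whose first argument is a variable; $\Pi_3$ if $A$ is a $sat\_cl5a$-atom whose first two arguments are unifiable; $\Pi_4$ if $A$ is any other $sat\_cl5a$-atom;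 $\Pi_5$ if $A$ has any other predicate symbol. Specification $S_3^0$. Let $L_1^0=\{[t_1-t'_1,\ldots,t_n-t'_n]\in\mathcal{HU}\mid n>0,\ t_i=t'_i\text{ for some }i\in\{1,\ldots,n\}\}$, $L_2^0=\{[s_1,\ldots,s_n]\mid n\ge0,\ s_1,\ldots,s_n\in L_1^0\}$, $TFL=\{[t_1,\ldots,t_n]\mid n\ge0,\ \text{each }t_i\in\{\mathtt{true},\mathtt{false}\}\}$. $S_3^0$ consists of the following ground atoms: $sat\_cl(s)$ for $s\in L_1^0$; $sat\_cnf(u)$ for $u\in L_2^0$; $t=t$ for $t\in\mathcal{HU}$; $sat\_cl3(s,v,p)$ for $[p-v|s]\in L_1^0$; $sat\_cl5(v_1,p_1,v_2,p_2,s)$ and $sat\_cl5a(v_1,p_1,v_2,p_2,s)$ for $[p_1-v_1,p_2-v_2|s]\in L_1^0$; $sat(u,t)$ for $u\in L_2^0$, $t\in TFL$; $tflist(t)$ for $t\in TFL$; $tf(\mathtt{true})$ and $tf(\mathtt{false})$. -}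

module Defs where

open import Data.Fin.Base using (Fin; toℕ)
open import Data.List.Base
  using (List; []; _∷_; _++_; length; lookup; map; concatMap; foldr; take; drop)
open import Data.List.Membership.Propositional using (_∈_)
open import Data.List.Relation.Unary.All using (All)
open import Data.List.Relation.Unary.Any using (Any)
open import Data.List.Relation.Unary.Unique.Propositional using (Unique)
open import Data.Empty using (⊥)
open import Data.Nat.Base using (ℕ; _<_)
open import Data.Nat.Properties using (_≟_)
open import Data.Product.Base using (Σ; ∃; ∃-syntax; _×_; _,_; proj₁; proj₂; uncurry)
open import Data.Sum.Base using (_⊎_)
open import Data.Vec.Base using (Vec; []; _∷_)
open import Function.Bundles using (_⇔_; _↔_; Inverse)
open import Level using (0ℓ)
open import Relation.Binary.PropositionalEquality using (_≡_; _≢_)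
open import Relation.Nullary using (¬_; yes; no)
open import Relation.Unary using (Pred; ∅; ｛_｝; _∪_; _∖_)

-- The symbols an alphabet may contain besides the ones occurring in P₃.
record Alphabet : Set₁ where
  field
    OtherFun   : Set
    otherFunAr : OtherFun → ℕ
    OtherPred   : Set
    otherPredAr : OtherPred → ℕ

data Literal : Set where
  pos neg : ℕ → Literal

PropClause CNF : Set
PropClause = List Literal
CNF        = List PropClause

module Language (𝒜 : Alphabet) where
  open Alphabet 𝒜

  data Fun : Set where
    nil cons minus true false : Fun
    other : OtherFun → Fun

  funAr : Fun → ℕ
  funAr nil       = 0
  funAr cons      = 2
  funAr minus     = 2
  funAr true      = 0
  funAr false     = 0
  funAr (other f) = otherFunAr f

  data PredSym : Set where
    sat-cnf sat-cl eq sat-cl3 sat-cl5 sat-cl5a sat tflist tf : PredSym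
    other : OtherPred → PredSym

  predAr : PredSym → ℕ
  predAr sat-cnf   = 1
  predAr sat-cl    = 1
  predAr eq        = 2
  predAr sat-cl3   = 3
  predAr sat-cl5   = 5
  predAr sat-cl5a  = 5
  predAr sat       = 2
  predAr tflist    = 1
  predAr tf        = 1
  predAr (other p) = otherPredAr p

  data Term : Set where
    var : ℕ → Term
    app : (f : Fun) → Vec Term (funAr f) → Term

  infix 8 _⟨_⟩
  data Atom : Set where
    _⟨_⟩ : (p : PredSym) → Vec Term (predAr p) → Atom

  Query : Set
  Query = List Atom

  infix 4 _←_
  record Clause : Set where
    constructor _←_
    field
      head : Atom
      body : Query
  open Clause public

  Program : Set₁
  Program = Pred Clause 0ℓ

  pattern []ᵗ       = app nil []
  pattern _∷ᵗ_ h t  = app cons (h ∷ t ∷ [])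
  pattern _-ᵗ_ p v  = app minus (p ∷ v ∷ [])
  pattern trueᵗ     = app true []
  pattern falseᵗ    = app false []
  infixr 6 _∷ᵗ_
  infix  7 _-ᵗ_

  listᵗ : List Term → Term
  listᵗ = foldr (λ h t → h ∷ᵗ t) []ᵗ

  mutual
    varsᵗ : Term → List ℕ
    varsᵗ (var x)    = x ∷ []
    varsᵗ (app f ts) = varsᵗˢ ts

    varsᵗˢ : ∀ {n} → Vec Term n → List ℕ
    varsᵗˢ []       = []
    varsᵗˢ (t ∷ ts) = varsᵗ t ++ varsᵗˢ ts

  varsᵃ : Atom → List ℕ
  varsᵃ (p ⟨ ts ⟩) = varsᵗˢ ts

  varsᑫ : Query → List ℕ
  varsᑫ = concatMap varsᵃ

  varsᶜ : Clause → List ℕ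
  varsᶜ (h ← b) = varsᵃ h ++ varsᑫ b

  HU : Pred Term 0ℓ
  HU t = varsᵗ t ≡ []

  Groundᑫ : Pred Query 0ℓ
  Groundᑫ Q = varsᑫ Q ≡ []

  mutual
    infixl 9 _[_]ᵗ _[_]ᵗˢ _[_]ᵃ _[_]ᑫ _[_]ᶜ

    _[_]ᵗ : Term → (ℕ → Term) → Term
    var x    [ σ ]ᵗ = σ x
    app f ts [ σ ]ᵗ = app f (ts [ σ ]ᵗˢ)

    _[_]ᵗˢ : ∀ {n} → Vec Term n → (ℕ → Term) → Vec Term n
    []       [ σ ]ᵗˢ = []
    (t ∷ ts) [ σ ]ᵗˢ = t [ σ ]ᵗ ∷ ts [ σ ]ᵗˢ

  _[_]ᵃ : Atom → (ℕ → Term) → Atom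
  (p ⟨ ts ⟩) [ σ ]ᵃ = p ⟨ ts [ σ ]ᵗˢ ⟩

  _[_]ᑫ : Query → (ℕ → Term) → Query
  Q [ σ ]ᑫ = map (_[ σ ]ᵃ) Q

  _[_]ᶜ : Clause → (ℕ → Term) → Clause
  (h ← b) [ σ ]ᶜ = h [ σ ]ᵃ ← b [ σ ]ᑫ

  -- Substitutions have finite domain; they are given by finite lists of
  -- bindings, of which the first one for a variable counts.
  Subst : Set
  Subst = List (ℕ × Term)

  ⟦_⟧ : Subst → ℕ → Term
  ⟦ [] ⟧          x = var x
  ⟦ (y , t) ∷ θ ⟧ x with x ≟ y
  ... | yes _ = t
  ... | no  _ = ⟦ θ ⟧ x

  -- Var(θ): the variables of the domain and of the range of θ.  It depends
  -- only on ⟦ θ ⟧, not on overridden or identity bindings in the list.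
  _∈Var_ : ℕ → Subst → Set
  y ∈Var θ = ∃[ x ] ⟦ θ ⟧ x ≢ var x × (y ≡ x ⊎ y ∈ varsᵗ (⟦ θ ⟧ x))

  Unifiableᵗ : Term → Term → Set
  Unifiableᵗ s t = ∃[ θ ] s [ ⟦ θ ⟧ ]ᵗ ≡ t [ ⟦ θ ⟧ ]ᵗ

  Unifier : Atom → Atom → Pred Subst 0ℓ
  Unifier A B θ = A [ ⟦ θ ⟧ ]ᵃ ≡ B [ ⟦ θ ⟧ ]ᵃ

  MGU : Atom → Atom → Pred Subst 0ℓ
  MGU A B θ = Unifier A B θ
            × (∀ σ → Unifier A B σ → ∃[ η ] (∀ x → ⟦ σ ⟧ x ≡ ⟦ θ ⟧ x [ ⟦ η ⟧ ]ᵗ))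

  InstanceOfᑫ : Query → Query → Set
  InstanceOfᑫ Q′ Q = ∃[ η ] Q′ ≡ Q [ ⟦ η ⟧ ]ᑫ

  VariantOf : Clause → Clause → Set
  VariantOf c′ c = Σ (ℕ ↔ ℕ) λ π → c′ ≡ c [ (λ x → var (Inverse.to π x)) ]ᶜ

  rule1 rule2 rule3 rule4 rule5 rule6 rule7 rule8 : Clause
  rule9 rule10 rule11 rule12 rule13 rule14 rule15 : Clause

  rule1 = sat-cnf ⟨ []ᵗ ∷ [] ⟩ ← []

  rule2 = sat-cnf ⟨ C ∷ᵗ Cs ∷ [] ⟩ ← sat-cl ⟨ C ∷ [] ⟩ ∷ sat-cnf ⟨ Cs ∷ [] ⟩ ∷ []
    where C = var 0 ; Cs = var 1

  rule3 = sat-cl ⟨ (P -ᵗ V) ∷ᵗ R ∷ [] ⟩ ← sat-cl3 ⟨ R ∷ V ∷ P ∷ [] ⟩ ∷ []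
    where P = var 0 ; V = var 1 ; R = var 2

  rule4 = eq ⟨ X ∷ X ∷ [] ⟩ ← []
    where X = var 0

  rule5 = sat-cl3 ⟨ []ᵗ ∷ V ∷ P ∷ [] ⟩ ← eq ⟨ V ∷ P ∷ [] ⟩ ∷ []
    where V = var 0 ; P = var 1

  rule6 = sat-cl3 ⟨ (P₂ -ᵗ V₂) ∷ᵗ R ∷ V₁ ∷ P₁ ∷ [] ⟩
        ← sat-cl5 ⟨ V₁ ∷ P₁ ∷ V₂ ∷ P₂ ∷ R ∷ [] ⟩ ∷ []
    where V₁ = var 0 ; P₁ = var 1 ; V₂ = var 2 ; P₂ = var 3 ; R = var 4

  rule7 = sat-cl5  ⟨ V₁ ∷ P₁ ∷ V₂ ∷ P₂ ∷ R ∷ [] ⟩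
        ← sat-cl5a ⟨ V₁ ∷ P₁ ∷ V₂ ∷ P₂ ∷ R ∷ [] ⟩ ∷ []
    where V₁ = var 0 ; P₁ = var 1 ; V₂ = var 2 ; P₂ = var 3 ; R = var 4

  rule8 = sat-cl5  ⟨ V₁ ∷ P₁ ∷ V₂ ∷ P₂ ∷ R ∷ [] ⟩
        ← sat-cl5a ⟨ V₂ ∷ P₂ ∷ V₁ ∷ P₁ ∷ R ∷ [] ⟩ ∷ []
    where V₁ = var 0 ; P₁ = var 1 ; V₂ = var 2 ; P₂ = var 3 ; R = var 4

  rule9 = sat-cl5a ⟨ V₁ ∷ P₁ ∷ V₂ ∷ P₂ ∷ R ∷ [] ⟩ ← eq ⟨ V₁ ∷ P₁ ∷ [] ⟩ ∷ []
    where V₁ = var 0 ; P₁ = var 1 ; V₂ = var 2 ; P₂ = var 3 ; R = var 4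

  rule10 = sat-cl5a ⟨ V₁ ∷ P₁ ∷ V₂ ∷ P₂ ∷ R ∷ [] ⟩
         ← sat-cl3 ⟨ R ∷ V₂ ∷ P₂ ∷ [] ⟩ ∷ []
    where V₁ = var 0 ; P₁ = var 1 ; V₂ = var 2 ; P₂ = var 3 ; R = var 4

  rule11 = sat ⟨ Cs ∷ Vs ∷ [] ⟩ ← sat-cnf ⟨ Cs ∷ [] ⟩ ∷ tflist ⟨ Vs ∷ [] ⟩ ∷ []
    where Cs = var 0 ; Vs = var 1

  rule12 = tflist ⟨ []ᵗ ∷ [] ⟩ ← []

  rule13 = tflist ⟨ V ∷ᵗ Vs ∷ [] ⟩ ← tflist ⟨ Vs ∷ [] ⟩ ∷ tf ⟨ V ∷ [] ⟩ ∷ []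
    where V = var 0 ; Vs = var 1

  rule14 = tf ⟨ trueᵗ ∷ [] ⟩ ← []

  rule15 = tf ⟨ falseᵗ ∷ [] ⟩ ← []

  P₃ : Program
  P₃ c = c ∈ rule1 ∷ rule2 ∷ rule3 ∷ rule4 ∷ rule5 ∷ rule6 ∷ rule7 ∷ rule8
           ∷ rule9 ∷ rule10 ∷ rule11 ∷ rule12 ∷ rule13 ∷ rule14 ∷ rule15 ∷ []

  data ProgramName : Set where
    ∅′ Π₁ Π₂ Π₃ Π₄ Π₅ : ProgramName

  program : ProgramName → Program
  program ∅′ = ∅
  program Π₁ = ｛ rule7 ｝
  program Π₂ = ｛ rule8 ｝
  program Π₃ = ｛ rule9 ｝
  program Π₄ = ｛ rule10 ｝
  program Π₅ = P₃ ∖ (program Π₁ ∪ program Π₂ ∪ program Π₃ ∪ program Π₄)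

  -- The arguments are the head and the tail of a non-empty query; the selected
  -- atom occurrence is given by its position.
  CSelectionRule : Set
  CSelectionRule = (A : Atom) (As : Query) → Fin (length (A ∷ As)) × ProgramName

  Selects : CSelectionRule → (Q : Query) → Fin (length Q) → ProgramName → Set
  Selects 𝓈 []       k i = ⊥
  Selects 𝓈 (A ∷ As) k i = 𝓈 A As ≡ (k , i)

  record Edge (Q : Query) : Set where
    field
      position : Fin (length Q)
      rule     : Clause
      input    : Clause
      mgu      : Subst

    selectedAtom : Atom
    selectedAtom = lookup Q position

    resolvent : Query
    resolvent = (take (toℕ position) Q ++ body input ++ drop (ℕ.suc (toℕ position)) Q)
                [ ⟦ mgu ⟧ ]ᑫ
  open Edge public

  -- Finite sequences of steps starting from Q₀.  The conditions making them
  -- initial segments of SLD-derivations are stated separately, in IsSLDStep.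
  mutual
    infixl 5 _▷_
    data Derivation (Q₀ : Query) : Set where
      ε   : Derivation Q₀
      _▷_ : (d : Derivation Q₀) → Edge (end d) → Derivation Q₀

    end : ∀ {Q₀} → Derivation Q₀ → Query
    end {Q₀} ε = Q₀
    end (d ▷ e) = resolvent e

  composedMgus : ∀ {Q₀} → Derivation Q₀ → ℕ → Term
  composedMgus ε       x = var x
  composedMgus (d ▷ e) x = composedMgus d x [ ⟦ mgu e ⟧ ]ᵗ

  UsedIn : ∀ {Q₀} → Derivation Q₀ → Pred ℕ 0ℓ
  UsedIn {Q₀} ε  y = y ∈ varsᑫ Q₀
  UsedIn (d ▷ e) y = UsedIn d y ⊎ y ∈ varsᶜ (input e) ⊎ y ∈Var mgu e

  record IsSLDStep {Q₀} (d : Derivation Q₀) (e : Edge (end d)) : Set where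
    field
      variant           : VariantOf (input e) (rule e)
      standardizedApart : ∀ {y} → y ∈ varsᶜ (input e) → ¬ UsedIn d y
      isMgu             : MGU (selectedAtom e) (head (input e)) (mgu e)

  ApplicableTo : Clause → Atom → Set
  ApplicableTo c A = ∃[ c′ ] VariantOf c′ c
                           × (∀ {y} → y ∈ varsᶜ c′ → ¬ y ∈ varsᵃ A)
                           × ∃ (Unifier A (head c′))

  -- A node is identified with the derivation labelling the path from the root
  -- to it, so a tree (possibly infinite) is a prefix-closed set of derivations.
  -- A node has exactly one child for each applicable rule of the selected
  -- program; the choice of the variant and of the mgu is left to the tree.
  record CsSLDTree (𝓈 : CSelectionRule) (Q₀ : Query) : Set₁ where
    field
      Node     : Pred (Derivation Q₀) 0ℓ
      root     : Node ε
      parent   : ∀ {d e} → Node (d ▷ e) → Node d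
      step     : ∀ {d e} → Node (d ▷ e) → IsSLDStep d e
      selected : ∀ {d e} → Node (d ▷ e) →
                 ∃[ i ] Selects 𝓈 (end d) (position e) i × program i (rule e)
      children : ∀ {d k i c} → Node d → Selects 𝓈 (end d) k i →
                 program i c → ApplicableTo c (lookup (end d) k) →
                 ∃[ e ] rule e ≡ c × Node (d ▷ e)
      unique   : ∀ {d e e′} → Node (d ▷ e) → Node (d ▷ e′) →
                 rule e ≡ rule e′ → e ≡ e′

  IsAnswerOf : ∀ {𝓈 Q₀} → Query → CsSLDTree 𝓈 Q₀ → Set
  IsAnswerOf {Q₀ = Q₀} Q T =
    ∃[ d ] CsSLDTree.Node T d × end d ≡ [] × Q ≡ Q₀ [ composedMgus d ]ᑫ

  CompleteWrt : ∀ {𝓈 Q₀} → Pred Atom 0ℓ → CsSLDTree 𝓈 Q₀ → Set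
  CompleteWrt {Q₀ = Q₀} S T =
    ∀ (θ : Subst) → let Q₀θ = Q₀ [ ⟦ θ ⟧ ]ᑫ in
    Groundᑫ Q₀θ → All S Q₀θ →
    ∃[ Q ] IsAnswerOf Q T × InstanceOfᑫ Q₀θ Q

  data Delayed : Pred Atom 0ℓ where
    delayed : ∀ {x p₁ y p₂ r} →
              Delayed (sat-cl5 ⟨ var x ∷ p₁ ∷ var y ∷ p₂ ∷ r ∷ [] ⟩)

  data ProgramFor : Atom → ProgramName → Set where
    cl5-nonvar    : ∀ {v₁ p₁ v₂ p₂ r} → (∀ x → v₁ ≢ var x) →
                    ProgramFor (sat-cl5 ⟨ v₁ ∷ p₁ ∷ v₂ ∷ p₂ ∷ r ∷ [] ⟩) Π₁
    cl5-var       : ∀ {x p₁ v₂ p₂ r} →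
                    ProgramFor (sat-cl5 ⟨ var x ∷ p₁ ∷ v₂ ∷ p₂ ∷ r ∷ [] ⟩) Π₂
    cl5a-unif     : ∀ {v₁ p₁ v₂ p₂ r} → Unifiableᵗ v₁ p₁ →
                    ProgramFor (sat-cl5a ⟨ v₁ ∷ p₁ ∷ v₂ ∷ p₂ ∷ r ∷ [] ⟩) Π₃
    cl5a-nonunif  : ∀ {v₁ p₁ v₂ p₂ r} → ¬ Unifiableᵗ v₁ p₁ →
                    ProgramFor (sat-cl5a ⟨ v₁ ∷ p₁ ∷ v₂ ∷ p₂ ∷ r ∷ [] ⟩) Π₄
    otherwise     : ∀ {p ts} → p ≢ sat-cl5 → p ≢ sat-cl5a →
                    ProgramFor (p ⟨ ts ⟩) Π₅

  ImplementsControl : CSelectionRule → Set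
  ImplementsControl 𝓈 = ∀ A As → let Q = A ∷ As ; k = proj₁ (𝓈 A As) ; i = proj₂ (𝓈 A As) in
      (All Delayed Q → i ≡ ∅′)
    × (¬ All Delayed Q → ¬ Delayed (lookup Q k) × ProgramFor (lookup Q k) i)

  L₁⁰ : Pred Term 0ℓ
  L₁⁰ t = ∃[ ps ] t ≡ listᵗ (map (uncurry (λ s s′ → s -ᵗ s′)) ps) × HU t
                × 0 < length ps × Any (uncurry _≡_) ps

  L₂⁰ : Pred Term 0ℓ
  L₂⁰ t = ∃[ ss ] t ≡ listᵗ ss × All L₁⁰ ss

  TFL : Pred Term 0ℓ
  TFL t = ∃[ ts ] t ≡ listᵗ ts × All (λ s → s ≡ trueᵗ ⊎ s ≡ falseᵗ) ts

  data S₃⁰ : Pred Atom 0ℓ where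
    sat-cl   : ∀ {s} → L₁⁰ s → S₃⁰ (sat-cl ⟨ s ∷ [] ⟩)
    sat-cnf  : ∀ {u} → L₂⁰ u → S₃⁰ (sat-cnf ⟨ u ∷ [] ⟩)
    eq       : ∀ {t} → HU t → S₃⁰ (eq ⟨ t ∷ t ∷ [] ⟩)
    sat-cl3  : ∀ {s v p} → L₁⁰ ((p -ᵗ v) ∷ᵗ s) → S₃⁰ (sat-cl3 ⟨ s ∷ v ∷ p ∷ [] ⟩)
    sat-cl5  : ∀ {v₁ p₁ v₂ p₂ s} → L₁⁰ ((p₁ -ᵗ v₁) ∷ᵗ (p₂ -ᵗ v₂) ∷ᵗ s) →
               S₃⁰ (sat-cl5 ⟨ v₁ ∷ p₁ ∷ v₂ ∷ p₂ ∷ s ∷ [] ⟩)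
    sat-cl5a : ∀ {v₁ p₁ v₂ p₂ s} → L₁⁰ ((p₁ -ᵗ v₁) ∷ᵗ (p₂ -ᵗ v₂) ∷ᵗ s) →
               S₃⁰ (sat-cl5a ⟨ v₁ ∷ p₁ ∷ v₂ ∷ p₂ ∷ s ∷ [] ⟩)
    sat      : ∀ {u t} → L₂⁰ u → TFL t → S₃⁰ (sat ⟨ u ∷ t ∷ [] ⟩)
    tflist   : ∀ {t} → TFL t → S₃⁰ (tflist ⟨ t ∷ [] ⟩)
    tf-true  : S₃⁰ (tf ⟨ trueᵗ ∷ [] ⟩)
    tf-false : S₃⁰ (tf ⟨ falseᵗ ∷ [] ⟩)

  -- The propositional variable number x is represented by the logical variable
  -- number x.

  repLiteral : Literal → Term
  repLiteral (pos x) = trueᵗ -ᵗ var x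
  repLiteral (neg x) = falseᵗ -ᵗ var x

  repClause : PropClause → Term
  repClause C = listᵗ (map repLiteral C)

  repCNF : CNF → Term
  repCNF φ = listᵗ (map repClause φ)

  -- l is a list of the variables of u, each occurring once, in any order.
  IsListOfVarsOf : Term → Term → Set
  IsListOfVarsOf l u =
    ∃[ xs ] l ≡ listᵗ (map var xs) × Unique xs × (∀ x → x ∈ xs ⇔ x ∈ varsᵗ u)

  satQuery : Term → Term → Query
  satQuery u l = sat ⟨ u ∷ l ∷ [] ⟩ ∷ []

{-# OPTIONS --safe #-}
module Submission where

-- Given θ, follow the branch of T on which every query, instantiated by a
-- substitution σ refining θ, stays true.  Pruning keeps such a branch: the
-- polarities in the query are always true or false, the variables take these
-- values under σ, and the first argument of a selected sat-cl5a-atom is already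
-- instantiated; hence it unifies with its polarity only if it equals it, and
-- otherwise the rest of the clause must be true.  For a sat-cl5-atom rules 7 and 8
-- are equally good, by symmetry.  The branch does not end in a query of delayed
-- atoms, since each variable of a query occurs in l, as long as sat(u, l) is
-- there, or in a remaining tflist- or tf-atom.  It is finite because each step
-- makes the instance of the query under σ lighter.

open import Defs

open import Data.Fin using (Fin; zero; suc; toℕ; #_)
open import Data.List.Base
  using (List; []; _∷_; _++_; length; lookup; map; take; drop)
open import Data.List.Membership.Propositional using (_∈_; _∉_; find; lose)
open import Data.List.Membership.Propositional.Properties
  using (∈-lookup; ∈-++⁺ˡ; ∈-++⁺ʳ; ∈-++⁻; ∈-map⁺; ∈-map⁻; ∈-concatMap⁺; ∈-concatMap⁻)
import Data.List.Membership.DecPropositional as DecMembership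
open import Data.List.Properties using (map-++)
open import Data.List.Relation.Unary.All as All using (All; []; _∷_)
open import Data.List.Relation.Unary.Any as Any using (Any; here; there)
open import Data.Nat.Base using (ℕ; suc; _+_; _∸_; _<_; _≤_; s≤s)
open import Data.Nat.Induction using (<-wellFounded)
open import Data.Nat.ListAction using (sum)
open import Data.Nat.ListAction.Properties using (sum-++)
open import Data.Nat.Properties
  using (_≟_; _<?_; m≤m+n; m≤n+m; ≤-trans; m+n∸m≡n; m+[n∸m]≡n; ≮⇒≥;
         +-monoʳ-<; +-monoˡ-<; +-cancelˡ-<; m+n≮m; module ≤-Reasoning)
open import Data.Nat.Tactic.RingSolver using (solve-∀)
open import Data.Product.Base using (∃-syntax; _×_; _,_; proj₁; proj₂; uncurry)
open import Data.Sum.Base using (_⊎_; inj₁; inj₂)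
open import Data.Vec.Base using (Vec; []; _∷_)
open import Function.Base using (_∘_)
open import Function.Bundles using (_↔_; Inverse; Injection; mk↔ₛ′; Equivalence)
open import Function.Properties.Inverse using (↔⇒↣)
open import Induction.WellFounded using (Acc; acc)
open import Relation.Binary.PropositionalEquality
open import Relation.Nullary using (¬_; Dec; yes; no; contradiction)
open import Relation.Nullary.Decidable using (from-yes)

-- Sums, a permutation of ℕ, positions in lists

∈⇒≤sum : ∀ {x xs} → x ∈ xs → x ≤ sum xs
∈⇒≤sum {xs = x ∷ xs} (here refl) = m≤m+n x (sum xs)
∈⇒≤sum {xs = y ∷ xs} (there p)   = ≤-trans (∈⇒≤sum p) (m≤n+m (sum xs) y)

-- Exchanges the blocks [0, N) and [N, 2N). The plain shift by `N` would also rename variables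
-- apart, but variants require a bijection of ℕ.
swapBlocks : ℕ → ℕ → ℕ
swapBlocks N x with x <? N
... | yes _ = N + x
... | no _  with x <? N + N
...   | yes _ = x ∸ N
...   | no _  = x

swapBlocks-low : ∀ {N x} → x < N → swapBlocks N x ≡ N + x
swapBlocks-low {N} {x} x<N with x <? N
... | yes _  = refl
... | no x≮N = contradiction x<N x≮N

swapBlocks-high : ∀ {N x} → x < N → swapBlocks N (N + x) ≡ x
swapBlocks-high {N} {x} x<N with N + x <? N
... | yes p = contradiction p (m+n≮m N x)
... | no _  with N + x <? N + N
...   | yes _ = m+n∸m≡n N x
...   | no ≮  = contradiction (+-monoʳ-< N x<N) ≮

swapBlocks-involutive : ∀ N x → swapBlocks N (swapBlocks N x) ≡ x
swapBlocks-involutive N x with x <? N in low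
... | yes x<N = swapBlocks-high x<N
... | no x≮N with x <? N + N in high
...   | yes x<2N = begin
  swapBlocks N (x ∸ N) ≡⟨ swapBlocks-low (+-cancelˡ-< N _ _ (subst (_< N + N) (sym N+[x∸N]≡x) x<2N)) ⟩
  N + (x ∸ N)          ≡⟨ N+[x∸N]≡x ⟩
  x                    ∎
  where
  open ≡-Reasoning
  N+[x∸N]≡x : N + (x ∸ N) ≡ x
  N+[x∸N]≡x = m+[n∸m]≡n (≮⇒≥ x≮N)
-- The inner swap fixes `x`, so the outer one repeats the same two failed comparisons.
...   | no _ rewrite low | high = refl

blockSwap : ℕ → ℕ ↔ ℕ
blockSwap N = mk↔ₛ′ (swapBlocks N) (swapBlocks N) (swapBlocks-involutive N) (swapBlocks-involutive N)

take-lookup-drop : ∀ {A : Set} (xs : List A) (k : Fin (length xs)) →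
                   xs ≡ take (toℕ k) xs ++ lookup xs k ∷ drop (suc (toℕ k)) xs
take-lookup-drop (x ∷ xs) zero    = refl
take-lookup-drop (x ∷ xs) (suc k) = cong (x ∷_) (take-lookup-drop xs k)

module _ {A : Set} {xs : List A} {k : Fin (length xs)} where

  ∈-take⁻ : ∀ {x} → x ∈ take (toℕ k) xs → x ∈ xs
  ∈-take⁻ p = subst (_ ∈_) (sym (take-lookup-drop xs k)) (∈-++⁺ˡ p)

  ∈-drop⁻ : ∀ {x} → x ∈ drop (suc (toℕ k)) xs → x ∈ xs
  ∈-drop⁻ p = subst (_ ∈_) (sym (take-lookup-drop xs k)) (∈-++⁺ʳ (take (toℕ k) xs) (there p))

  ∈-split : ∀ {x} → x ∈ xs → x ∈ take (toℕ k) xs ⊎ x ≡ lookup xs k ⊎ x ∈ drop (suc (toℕ k)) xs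
  ∈-split p with ∈-++⁻ (take (toℕ k) xs) (subst (_ ∈_) (take-lookup-drop xs k) p)
  ... | inj₁ q           = inj₁ q
  ... | inj₂ (here x≡)   = inj₂ (inj₁ x≡)
  ... | inj₂ (there q)   = inj₂ (inj₂ q)

module _ (𝒜 : Alphabet) where
  open Language 𝒜

  Substitution : Set
  Substitution = ℕ → Term

  infixl 8 _⨟_
  _⨟_ : Substitution → Substitution → Substitution
  (σ ⨟ η) x = σ x [ η ]ᵗ

  -- Substitutions and variables

  mutual
    []ᵗ-⨟ : ∀ {σ η} t → t [ σ ⨟ η ]ᵗ ≡ t [ σ ]ᵗ [ η ]ᵗ
    []ᵗ-⨟ (var x)    = refl
    []ᵗ-⨟ (app f ts) = cong (app f) ([]ᵗˢ-⨟ ts)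

    []ᵗˢ-⨟ : ∀ {σ η n} (ts : Vec Term n) → ts [ σ ⨟ η ]ᵗˢ ≡ ts [ σ ]ᵗˢ [ η ]ᵗˢ
    []ᵗˢ-⨟ []       = refl
    []ᵗˢ-⨟ (t ∷ ts) = cong₂ _∷_ ([]ᵗ-⨟ t) ([]ᵗˢ-⨟ ts)

  []ᵃ-⨟ : ∀ {σ η} A → A [ σ ⨟ η ]ᵃ ≡ A [ σ ]ᵃ [ η ]ᵃ
  []ᵃ-⨟ (p ⟨ ts ⟩) = cong (p ⟨_⟩) ([]ᵗˢ-⨟ ts)

  []ᑫ-⨟ : ∀ {σ η} Q → Q [ σ ⨟ η ]ᑫ ≡ Q [ σ ]ᑫ [ η ]ᑫ
  []ᑫ-⨟ []      = refl
  []ᑫ-⨟ (A ∷ Q) = cong₂ _∷_ ([]ᵃ-⨟ A) ([]ᑫ-⨟ Q)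

  AgreeOn : List ℕ → Substitution → Substitution → Set
  AgreeOn xs σ τ = ∀ {x} → x ∈ xs → σ x ≡ τ x

  mutual
    []ᵗ-cong : ∀ {σ τ} t → AgreeOn (varsᵗ t) σ τ → t [ σ ]ᵗ ≡ t [ τ ]ᵗ
    []ᵗ-cong (var x)    h = h (here refl)
    []ᵗ-cong (app f ts) h = cong (app f) ([]ᵗˢ-cong ts h)

    []ᵗˢ-cong : ∀ {σ τ n} (ts : Vec Term n) → AgreeOn (varsᵗˢ ts) σ τ → ts [ σ ]ᵗˢ ≡ ts [ τ ]ᵗˢ
    []ᵗˢ-cong []       h = refl
    []ᵗˢ-cong (t ∷ ts) h =
      cong₂ _∷_ ([]ᵗ-cong t (h ∘ ∈-++⁺ˡ)) ([]ᵗˢ-cong ts (h ∘ ∈-++⁺ʳ (varsᵗ t)))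

  []ᵃ-cong : ∀ {σ τ} A → AgreeOn (varsᵃ A) σ τ → A [ σ ]ᵃ ≡ A [ τ ]ᵃ
  []ᵃ-cong (p ⟨ ts ⟩) h = cong (p ⟨_⟩) ([]ᵗˢ-cong ts h)

  []ᑫ-cong : ∀ {σ τ} Q → AgreeOn (varsᑫ Q) σ τ → Q [ σ ]ᑫ ≡ Q [ τ ]ᑫ
  []ᑫ-cong []      h = refl
  []ᑫ-cong (A ∷ Q) h =
    cong₂ _∷_ ([]ᵃ-cong A (h ∘ ∈-++⁺ˡ)) ([]ᑫ-cong Q (h ∘ ∈-++⁺ʳ (varsᵃ A)))

  mutual
    []ᵗ-var : ∀ t → t [ var ]ᵗ ≡ t
    []ᵗ-var (var x)    = refl
    []ᵗ-var (app f ts) = cong (app f) ([]ᵗˢ-var ts)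

    []ᵗˢ-var : ∀ {n} (ts : Vec Term n) → ts [ var ]ᵗˢ ≡ ts
    []ᵗˢ-var []       = refl
    []ᵗˢ-var (t ∷ ts) = cong₂ _∷_ ([]ᵗ-var t) ([]ᵗˢ-var ts)

  []ᑫ-var : ∀ Q → Q [ var ]ᑫ ≡ Q
  []ᑫ-var []             = refl
  []ᑫ-var (p ⟨ ts ⟩ ∷ Q) = cong₂ _∷_ (cong (p ⟨_⟩) ([]ᵗˢ-var ts)) ([]ᑫ-var Q)

  mutual
    varsᵗ-[]⁻ : ∀ {σ y} t → y ∈ varsᵗ (t [ σ ]ᵗ) → ∃[ x ] x ∈ varsᵗ t × y ∈ varsᵗ (σ x)
    varsᵗ-[]⁻ (var x)    p = x , here refl , p
    varsᵗ-[]⁻ (app f ts) p = varsᵗˢ-[]⁻ ts p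

    varsᵗˢ-[]⁻ : ∀ {σ y n} (ts : Vec Term n) → y ∈ varsᵗˢ (ts [ σ ]ᵗˢ) →
                 ∃[ x ] x ∈ varsᵗˢ ts × y ∈ varsᵗ (σ x)
    varsᵗˢ-[]⁻ {σ} (t ∷ ts) p with ∈-++⁻ (varsᵗ (t [ σ ]ᵗ)) p
    ... | inj₁ q = let x , x∈ , y∈ = varsᵗ-[]⁻ t q in x , ∈-++⁺ˡ x∈ , y∈
    ... | inj₂ q = let x , x∈ , y∈ = varsᵗˢ-[]⁻ ts q in x , ∈-++⁺ʳ (varsᵗ t) x∈ , y∈

  mutual
    varsᵗ-[]⁺ : ∀ {σ x y} t → x ∈ varsᵗ t → y ∈ varsᵗ (σ x) → y ∈ varsᵗ (t [ σ ]ᵗ)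
    varsᵗ-[]⁺ (var x)    (here refl) q = q
    varsᵗ-[]⁺ (app f ts) p           q = varsᵗˢ-[]⁺ ts p q

    varsᵗˢ-[]⁺ : ∀ {σ x y n} (ts : Vec Term n) → x ∈ varsᵗˢ ts → y ∈ varsᵗ (σ x) →
                 y ∈ varsᵗˢ (ts [ σ ]ᵗˢ)
    varsᵗˢ-[]⁺ {σ} (t ∷ ts) p q with ∈-++⁻ (varsᵗ t) p
    ... | inj₁ p′ = ∈-++⁺ˡ (varsᵗ-[]⁺ t p′ q)
    ... | inj₂ p′ = ∈-++⁺ʳ (varsᵗ (t [ σ ]ᵗ)) (varsᵗˢ-[]⁺ ts p′ q)

  varsᵃ-[]⁻ : ∀ {σ y} A → y ∈ varsᵃ (A [ σ ]ᵃ) → ∃[ x ] x ∈ varsᵃ A × y ∈ varsᵗ (σ x)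
  varsᵃ-[]⁻ (p ⟨ ts ⟩) = varsᵗˢ-[]⁻ ts

  varsᵃ-[]⁺ : ∀ {σ x y} A → x ∈ varsᵃ A → y ∈ varsᵗ (σ x) → y ∈ varsᵃ (A [ σ ]ᵃ)
  varsᵃ-[]⁺ (p ⟨ ts ⟩) = varsᵗˢ-[]⁺ ts

  varsᑫ⁺ : ∀ {A Q y} → A ∈ Q → y ∈ varsᵃ A → y ∈ varsᑫ Q
  varsᑫ⁺ A∈Q y∈A = ∈-concatMap⁺ varsᵃ (lose A∈Q y∈A)

  varsᑫ⁻ : ∀ {Q y} → y ∈ varsᑫ Q → ∃[ A ] A ∈ Q × y ∈ varsᵃ A
  varsᑫ⁻ {Q} p = find (∈-concatMap⁻ varsᵃ {xs = Q} p)

  varsᑫ-[]⁻ : ∀ {σ y} Q → y ∈ varsᑫ (Q [ σ ]ᑫ) → ∃[ x ] x ∈ varsᑫ Q × y ∈ varsᵗ (σ x)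
  varsᑫ-[]⁻ {σ} Q p with varsᑫ⁻ {Q [ σ ]ᑫ} p
  ... | _ , B∈ , y∈ with ∈-map⁻ (_[ σ ]ᵃ) B∈
  ...   | A , A∈Q , refl = let x , x∈ , y∈σx = varsᵃ-[]⁻ A y∈ in x , varsᑫ⁺ A∈Q x∈ , y∈σx

  varsᶜ-[]⁻ : ∀ {σ y} c → y ∈ varsᶜ (c [ σ ]ᶜ) → ∃[ x ] x ∈ varsᶜ c × y ∈ varsᵗ (σ x)
  varsᶜ-[]⁻ {σ} (h ← b) p with ∈-++⁻ (varsᵃ (h [ σ ]ᵃ)) p
  ... | inj₁ q = let x , x∈ , y∈ = varsᵃ-[]⁻ h q in x , ∈-++⁺ˡ x∈ , y∈
  ... | inj₂ q = let x , x∈ , y∈ = varsᑫ-[]⁻ b q in x , ∈-++⁺ʳ (varsᵃ h) x∈ , y∈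

  -- Terms over an arbitrary alphabet need not have decidable equality; equality with a variable is
  -- decidable, and that suffices to tell whether a substitution moves `x`.
  _≟var_ : ∀ t x → Dec (t ≡ var x)
  app f ts ≟var x = no λ ()
  var y    ≟var x with y ≟ x
  ... | yes refl = yes refl
  ... | no  y≢x  = no λ { refl → y≢x refl }

  ∈-vars-⟦⟧ : ∀ {θ x y} → y ∈ varsᵗ (⟦ θ ⟧ x) → y ≡ x ⊎ y ∈Var θ
  ∈-vars-⟦⟧ {θ} {x} {y} p with ⟦ θ ⟧ x ≟var x
  ... | no  θx≢x = inj₂ (x , θx≢x , inj₂ p)
  ... | yes θx≡x with subst (λ t → y ∈ varsᵗ t) θx≡x p
  ...   | here y≡x = inj₁ y≡x

  -- Lifting

  -- Turns an arbitrary function `τ` on the variables of a clause, renamed by `π`, into finitely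
  -- many bindings put before `σ`. Generality of an mgu is only available against finite
  -- substitutions.
  rebind : (ℕ → ℕ) → Substitution → List ℕ → Subst → Subst
  rebind π τ []       σ = σ
  rebind π τ (x ∷ xs) σ = (π x , τ x) ∷ rebind π τ xs σ

  -- Bindings added earlier or repeated do no harm: by injectivity of `π`, every binding for `π x`
  -- has the value `τ x`.
  rebind-∈ : ∀ {π τ σ x xs} → (∀ {x y} → π x ≡ π y → x ≡ y) → x ∈ xs →
             ⟦ rebind π τ xs σ ⟧ (π x) ≡ τ x
  rebind-∈ {π} {τ} {x = x} {xs = z ∷ xs} inj p with π x ≟ π z | p
  ... | yes πx≡πz | _         = cong τ (sym (inj πx≡πz))
  ... | no  πx≢πz | here refl = contradiction refl πx≢πz
  ... | no  _     | there q   = rebind-∈ inj q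

  rebind-∉ : ∀ {π τ σ y} xs → (∀ {x} → x ∈ xs → y ≢ π x) → ⟦ rebind π τ xs σ ⟧ y ≡ ⟦ σ ⟧ y
  rebind-∉ []               h = refl
  rebind-∉ {π} {y = y} (x ∷ xs) h with y ≟ π x
  ... | yes y≡πx = contradiction y≡πx (h (here refl))
  ... | no  _    = rebind-∉ xs (h ∘ there)

  module Rebinding (π : ℕ ↔ ℕ) (c : Clause) (σ : Subst) (τ : Substitution) where
    ren : Substitution
    ren x = var (Inverse.to π x)

    rebound : Subst
    rebound = rebind (Inverse.to π) τ (varsᶜ c) σ

    rebound-∈ : AgreeOn (varsᶜ c) (ren ⨟ ⟦ rebound ⟧) τ
    rebound-∈ = rebind-∈ (Injection.injective (↔⇒↣ π))

    vars-variant : ∀ {x} → x ∈ varsᶜ c → Inverse.to π x ∈ varsᶜ (c [ ren ]ᶜ)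
    vars-variant x∈ with ∈-++⁻ (varsᵃ (head c)) x∈
    ... | inj₁ q = ∈-++⁺ˡ (varsᵃ-[]⁺ (head c) q (here refl))
    ... | inj₂ q = let B , B∈ , x∈B = varsᑫ⁻ {body c} q in
      ∈-++⁺ʳ (varsᵃ (head c [ ren ]ᵃ)) (varsᑫ⁺ (∈-map⁺ (_[ ren ]ᵃ) B∈) (varsᵃ-[]⁺ B x∈B (here refl)))

    rebound-∉ : ∀ {y} → y ∉ varsᶜ (c [ ren ]ᶜ) → ⟦ rebound ⟧ y ≡ ⟦ σ ⟧ y
    rebound-∉ y∉ = rebind-∉ (varsᶜ c) λ { x∈ refl → y∉ (vars-variant x∈) }

    head-rebound : head (c [ ren ]ᶜ) [ ⟦ rebound ⟧ ]ᵃ ≡ head c [ τ ]ᵃ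
    head-rebound = trans (sym ([]ᵃ-⨟ (head c))) ([]ᵃ-cong (head c) (rebound-∈ ∘ ∈-++⁺ˡ))

    body-rebound : body (c [ ren ]ᶜ) [ ⟦ rebound ⟧ ]ᑫ ≡ body c [ τ ]ᑫ
    body-rebound = trans (sym ([]ᑫ-⨟ (body c))) ([]ᑫ-cong (body c) (rebound-∈ ∘ ∈-++⁺ʳ (varsᵃ (head c))))

    -- On `A` the rebound substitution acts as `σ`, since the variant shares no variable with `A`;
    -- on the head of the variant it undoes the renaming and applies `τ`.
    unifies : ∀ {A} → (∀ {y} → y ∈ varsᶜ (c [ ren ]ᶜ) → ¬ y ∈ varsᵃ A) →
              A [ ⟦ σ ⟧ ]ᵃ ≡ head c [ τ ]ᵃ → Unifier A (head (c [ ren ]ᶜ)) rebound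
    unifies {A} apart inst = trans ([]ᵃ-cong A λ y∈A → rebound-∉ λ y∈c → apart y∈c y∈A)
                                 (trans inst (sym head-rebound))

  instance⇒applicable : ∀ {c A} σ τ → A [ ⟦ σ ⟧ ]ᵃ ≡ head c [ τ ]ᵃ → ApplicableTo c A
  instance⇒applicable {c} {A} σ τ inst =
    c [ ren ]ᶜ , (blockSwap N , refl) , apart , rebound , unifies apart inst
    where
    -- `N` exceeds every variable of `A` and `c`, so the swap shifts all variables of `c` beyond
    -- those of `A`.
    N = suc (sum (varsᵃ A ++ varsᶜ c))
    open Rebinding (blockSwap N) c σ τ
    apart : ∀ {y} → y ∈ varsᶜ (c [ ren ]ᶜ) → ¬ y ∈ varsᵃ A
    apart {y} y∈c y∈A with varsᶜ-[]⁻ c y∈c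
    ... | x , x∈c , here y≡ = m+n≮m N x (subst (_< N) y≡N+x (s≤s (∈⇒≤sum (∈-++⁺ˡ y∈A))))
      where
      y≡N+x : y ≡ N + x
      y≡N+x = trans y≡ (swapBlocks-low (s≤s (∈⇒≤sum (∈-++⁺ʳ (varsᵃ A) x∈c))))

  resolvent-vars : ∀ {Q} (e : Edge Q) {y} → y ∈ varsᑫ (resolvent e) →
                   y ∈ varsᑫ Q ⊎ y ∈ varsᶜ (input e) ⊎ y ∈Var mgu e
  resolvent-vars {Q} e y∈ with varsᑫ-[]⁻ (take (toℕ (position e)) Q ++ _) y∈
  ... | x , x∈ , y∈x with ∈-vars-⟦⟧ {mgu e} y∈x
  ...   | inj₂ y∈mgu = inj₂ (inj₂ y∈mgu)
  ...   | inj₁ refl with varsᑫ⁻ {take (toℕ (position e)) Q ++ _} x∈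
  ...     | B , B∈ , x∈B with ∈-++⁻ (take (toℕ (position e)) Q) B∈
  ...       | inj₁ B∈t = inj₁ (varsᑫ⁺ (∈-take⁻ {k = position e} B∈t) x∈B)
  ...       | inj₂ B∈′ with ∈-++⁻ (body (input e)) B∈′
  ...         | inj₁ B∈b = inj₂ (inj₁ (∈-++⁺ʳ (varsᵃ (head (input e))) (varsᑫ⁺ B∈b x∈B)))
  ...         | inj₂ B∈d = inj₁ (varsᑫ⁺ (∈-drop⁻ {xs = Q} {k = position e} B∈d) x∈B)

  module _ {Q₀ : Query} where

    -- Standardization apart is phrased by `UsedIn`; this makes it apply to the current query.
    end-vars⊆used : ∀ (d : Derivation Q₀) {y} → y ∈ varsᑫ (end d) → UsedIn d y
    end-vars⊆used ε       y∈ = y∈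
    end-vars⊆used (d ▷ e) y∈ with resolvent-vars e y∈
    ... | inj₁ p = inj₁ (end-vars⊆used d p)
    ... | inj₂ p = inj₂ p

    partialAnswer : Derivation Q₀ → Query
    partialAnswer d = Q₀ [ composedMgus d ]ᑫ

    partialAnswer-▷ : ∀ d e → partialAnswer (d ▷ e) ≡ partialAnswer d [ ⟦ mgu e ⟧ ]ᑫ
    partialAnswer-▷ d e = []ᑫ-⨟ Q₀

    partialAnswer-vars⊆used : ∀ (d : Derivation Q₀) {y} → y ∈ varsᑫ (partialAnswer d) → UsedIn d y
    partialAnswer-vars⊆used ε {y} y∈ = subst (λ Q → y ∈ varsᑫ Q) ([]ᑫ-var Q₀) y∈
    partialAnswer-vars⊆used (d ▷ e) {y} y∈
      with varsᑫ-[]⁻ (partialAnswer d) (subst (λ Q → y ∈ varsᑫ Q) (partialAnswer-▷ d e) y∈)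
    ... | x , x∈ , y∈x with ∈-vars-⟦⟧ {mgu e} y∈x
    ...   | inj₁ refl  = inj₁ (partialAnswer-vars⊆used d x∈)
    ...   | inj₂ y∈mgu = inj₂ (inj₂ y∈mgu)

  Selects-functional : ∀ {𝓈} Q {k k′ i i′} → Selects 𝓈 Q k i → Selects 𝓈 Q k′ i′ → k ≡ k′
  Selects-functional (A ∷ As) p q = cong proj₁ (trans (sym p) q)

  -- The lifting lemma: the step from σ by the instance of c under τ is an
  -- instance, by η, of a step in the tree; τ′ is the renaming of c into the input
  -- clause followed by the mgu.
  record LiftedStep {𝓈 Q₀} (T : CsSLDTree 𝓈 Q₀) (d : Derivation Q₀) (k : Fin (length (end d)))
                    (c : Clause) (σ : Subst) (τ : Substitution) : Set where
    field
      edge      : Edge (end d)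
      node      : CsSLDTree.Node T (d ▷ edge)
      η         : Subst
      τ′        : Substitution
      agrees    : ∀ {x} → UsedIn d x → ⟦ σ ⟧ x ≡ (⟦ mgu edge ⟧ ⨟ ⟦ η ⟧) x
      head-eq   : lookup (end d) k [ ⟦ mgu edge ⟧ ]ᵃ ≡ head c [ τ′ ]ᵃ
      body-eq   : body c [ τ′ ]ᑫ [ ⟦ η ⟧ ]ᑫ ≡ body c [ τ ]ᑫ
      resolves  : resolvent edge ≡ take (toℕ k) (end d) [ ⟦ mgu edge ⟧ ]ᑫ ++ body c [ τ′ ]ᑫ
                                   ++ drop (suc (toℕ k)) (end d) [ ⟦ mgu edge ⟧ ]ᑫ

  -- The tree has a child for `c` because an instance of the selected atom matches its head. The
  -- rebound substitution unifies the selected atom with the head of the input clause, so it factors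
  -- through the mgu chosen by the tree, which yields `η`. It agrees with `σ` on used variables by
  -- standardization apart.
  lift : ∀ {𝓈 Q₀} (T : CsSLDTree 𝓈 Q₀) {d k i c} → CsSLDTree.Node T d → Selects 𝓈 (end d) k i →
         program i c → ∀ σ τ → lookup (end d) k [ ⟦ σ ⟧ ]ᵃ ≡ head c [ τ ]ᵃ → LiftedStep T d k c σ τ
  lift T {d} {k} {i} {c} nd sel c∈i σ τ inst
    with CsSLDTree.children T nd sel c∈i (instance⇒applicable σ τ inst)
  ... | e , refl , nde with CsSLDTree.step T nde | CsSLDTree.selected T nde
  ...   | st | _ , sel′ , _ with Selects-functional (end d) sel sel′
  ...     | refl with IsSLDStep.variant st | IsSLDStep.isMgu st
  ...       | π , input≡ | unif , general = record
    { edge     = e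
    ; node     = nde
    ; η        = proj₁ instantiation
    ; τ′       = ren ⨟ ⟦ mgu e ⟧
    ; agrees   = λ {x} used → trans (sym (rebound-∉ λ x∈ → apart x∈ used)) (proj₂ instantiation x)
    ; head-eq  = trans unif (trans (cong (λ c′ → head c′ [ ⟦ mgu e ⟧ ]ᵃ) input≡) (sym ([]ᵃ-⨟ (head c))))
    ; body-eq  = begin
        body c [ ren ⨟ ⟦ mgu e ⟧ ]ᑫ [ ⟦ proj₁ instantiation ⟧ ]ᑫ
          ≡⟨ cong (_[ ⟦ proj₁ instantiation ⟧ ]ᑫ) ([]ᑫ-⨟ (body c)) ⟩
        body c [ ren ]ᑫ [ ⟦ mgu e ⟧ ]ᑫ [ ⟦ proj₁ instantiation ⟧ ]ᑫ
          ≡⟨ []ᑫ-⨟ (body c [ ren ]ᑫ) ⟨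
        body c [ ren ]ᑫ [ ⟦ mgu e ⟧ ⨟ ⟦ proj₁ instantiation ⟧ ]ᑫ
          ≡⟨ []ᑫ-cong (body c [ ren ]ᑫ) (λ {x} _ → proj₂ instantiation x) ⟨
        body c [ ren ]ᑫ [ ⟦ rebound ⟧ ]ᑫ
          ≡⟨ body-rebound ⟩
        body c [ τ ]ᑫ ∎
    ; resolves = begin
        resolvent e
          ≡⟨ map-++ _ (take (toℕ k) (end d)) _ ⟩
        take (toℕ k) (end d) [ ⟦ mgu e ⟧ ]ᑫ ++ (body (input e) ++ drop (suc (toℕ k)) (end d)) [ ⟦ mgu e ⟧ ]ᑫ
          ≡⟨ cong (take (toℕ k) (end d) [ ⟦ mgu e ⟧ ]ᑫ ++_) (map-++ _ (body (input e)) _) ⟩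
        take (toℕ k) (end d) [ ⟦ mgu e ⟧ ]ᑫ ++ body (input e) [ ⟦ mgu e ⟧ ]ᑫ
          ++ drop (suc (toℕ k)) (end d) [ ⟦ mgu e ⟧ ]ᑫ
          ≡⟨ cong (λ b → take (toℕ k) (end d) [ ⟦ mgu e ⟧ ]ᑫ ++ b ++ drop (suc (toℕ k)) (end d) [ ⟦ mgu e ⟧ ]ᑫ)
                  (trans (cong (λ c′ → body c′ [ ⟦ mgu e ⟧ ]ᑫ) input≡) (sym ([]ᑫ-⨟ (body c)))) ⟩
        take (toℕ k) (end d) [ ⟦ mgu e ⟧ ]ᑫ ++ body c [ ren ⨟ ⟦ mgu e ⟧ ]ᑫ
          ++ drop (suc (toℕ k)) (end d) [ ⟦ mgu e ⟧ ]ᑫ ∎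
    }
    where
    open ≡-Reasoning
    open Rebinding π c σ τ
    apart : ∀ {y} → y ∈ varsᶜ (c [ ren ]ᶜ) → ¬ UsedIn d y
    apart {y} y∈ = IsSLDStep.standardizedApart st (subst (λ c′ → y ∈ varsᶜ c′) (sym input≡) y∈)
    instantiation : ∃[ η ] (∀ x → ⟦ rebound ⟧ x ≡ ⟦ mgu e ⟧ x [ ⟦ η ⟧ ]ᵗ)
    instantiation = general rebound
      (subst (λ c′ → Unifier (lookup (end d) k) (head c′) rebound) (sym input≡)
        (unifies (λ y∈c y∈A → apart y∈c (end-vars⊆used d (varsᑫ⁺ (∈-lookup {xs = end d} k) y∈A))) inst))

  -- Atoms true under σ

  TruthValue : Term → Set
  TruthValue t = t ≡ trueᵗ ⊎ t ≡ falseᵗ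

  data Literals (σ : Substitution) : Term → Set where
    []  : Literals σ []ᵗ
    _∷_ : ∀ {p v r} → TruthValue p × TruthValue (v [ σ ]ᵗ) → Literals σ r →
          Literals σ ((p -ᵗ v) ∷ᵗ r)

  data Satisfied (σ : Substitution) : Term → Set where
    here  : ∀ {p v r} → v [ σ ]ᵗ ≡ p [ σ ]ᵗ → Satisfied σ ((p -ᵗ v) ∷ᵗ r)
    there : ∀ {l r} → Satisfied σ r → Satisfied σ (l ∷ᵗ r)

  TrueClause : Substitution → Term → Set
  TrueClause σ t = Literals σ t × Satisfied σ t

  data Listᵗ (P : Term → Set) : Term → Set where
    []  : Listᵗ P []ᵗ
    _∷_ : ∀ {h t} → P h → Listᵗ P t → Listᵗ P (h ∷ᵗ t)

  TrueCNF TruthValues : Substitution → Term → Set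
  TrueCNF σ     = Listᵗ (TrueClause σ)
  TruthValues σ = Listᵗ (λ v → TruthValue (v [ σ ]ᵗ))

  -- The nodes of the tree consist of such atoms.  Polarities are truth values
  -- already before σ is applied; in sat-cl5a the control ensures that of v₁ too.
  data Good (σ : Substitution) : Atom → Set where
    good-sat    : ∀ {u l} → TrueCNF σ u → TruthValues σ l → Good σ (sat ⟨ u ∷ l ∷ [] ⟩)
    good-cnf    : ∀ {u} → TrueCNF σ u → Good σ (sat-cnf ⟨ u ∷ [] ⟩)
    good-cl     : ∀ {t} → TrueClause σ t → Good σ (sat-cl ⟨ t ∷ [] ⟩)
    good-eq     : ∀ {s t} → s [ σ ]ᵗ ≡ t [ σ ]ᵗ → Good σ (eq ⟨ s ∷ t ∷ [] ⟩)
    good-cl3    : ∀ {r v p} → TrueClause σ ((p -ᵗ v) ∷ᵗ r) → Good σ (sat-cl3 ⟨ r ∷ v ∷ p ∷ [] ⟩)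
    good-cl5    : ∀ {v₁ p₁ v₂ p₂ r} → TrueClause σ ((p₁ -ᵗ v₁) ∷ᵗ (p₂ -ᵗ v₂) ∷ᵗ r) →
                  Good σ (sat-cl5 ⟨ v₁ ∷ p₁ ∷ v₂ ∷ p₂ ∷ r ∷ [] ⟩)
    good-cl5a   : ∀ {v₁ p₁ v₂ p₂ r} → TruthValue v₁ → TrueClause σ ((p₁ -ᵗ v₁) ∷ᵗ (p₂ -ᵗ v₂) ∷ᵗ r) →
                  Good σ (sat-cl5a ⟨ v₁ ∷ p₁ ∷ v₂ ∷ p₂ ∷ r ∷ [] ⟩)
    good-tflist : ∀ {l} → TruthValues σ l → Good σ (tflist ⟨ l ∷ [] ⟩)
    good-tf     : ∀ {v} → TruthValue (v [ σ ]ᵗ) → Good σ (tf ⟨ v ∷ [] ⟩)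

  ∷ᵗ-injective : ∀ {s t s′ t′ : Term} → s ∷ᵗ t ≡ s′ ∷ᵗ t′ → s ≡ s′ × t ≡ t′
  ∷ᵗ-injective refl = refl , refl

  -ᵗ-injective : ∀ {s t s′ t′ : Term} → s -ᵗ t ≡ s′ -ᵗ t′ → s ≡ s′ × t ≡ t′
  -ᵗ-injective refl = refl , refl

  ⟨⟩-injective : ∀ {p ts us} → p ⟨ ts ⟩ ≡ p ⟨ us ⟩ → ts ≡ us
  ⟨⟩-injective refl = refl

  Vec-∷-injective : ∀ {n} {t u : Term} {ts us : Vec Term n} →
                    _≡_ {A = Vec Term (suc n)} (t ∷ ts) (u ∷ us) → t ≡ u × ts ≡ us
  Vec-∷-injective refl = refl , refl

  TruthValue-[] : ∀ {t} σ → TruthValue t → TruthValue (t [ σ ]ᵗ)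
  TruthValue-[] σ (inj₁ refl) = inj₁ refl
  TruthValue-[] σ (inj₂ refl) = inj₂ refl

  -- Substitution keeps the outermost symbol of a nonvariable term, and the truth values are
  -- constants. Thus a nonvariable argument whose instance is a truth value is already instantiated.
  TruthValue-nonvar : ∀ {σ} t → (∀ x → t ≢ var x) → TruthValue (t [ σ ]ᵗ) → TruthValue t
  TruthValue-nonvar (var x)           nv _         = contradiction refl (nv x)
  TruthValue-nonvar trueᵗ             _  _         = inj₁ refl
  TruthValue-nonvar falseᵗ            _  _         = inj₂ refl
  TruthValue-nonvar (app nil ts)      _  (inj₁ ())
  TruthValue-nonvar (app nil ts)      _  (inj₂ ())
  TruthValue-nonvar (app cons ts)     _  (inj₁ ())
  TruthValue-nonvar (app cons ts)     _  (inj₂ ())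
  TruthValue-nonvar (app minus ts)    _  (inj₁ ())
  TruthValue-nonvar (app minus ts)    _  (inj₂ ())
  TruthValue-nonvar (app (other f) _) _  (inj₁ ())
  TruthValue-nonvar (app (other f) _) _  (inj₂ ())

  -- Distinct constants have no unifier. Between truth values the unifiability test of the control
  -- is therefore a test for equality.
  TruthValue-≡ : ∀ {s t} σ → TruthValue s → TruthValue t → s [ σ ]ᵗ ≡ t [ σ ]ᵗ → s ≡ t
  TruthValue-≡ σ (inj₁ refl) (inj₁ refl) _ = refl
  TruthValue-≡ σ (inj₂ refl) (inj₂ refl) _ = refl
  TruthValue-≡ σ (inj₁ refl) (inj₂ refl) ()
  TruthValue-≡ σ (inj₂ refl) (inj₁ refl) ()

  -- Truth depends only on the ground instance, so it survives applying a
  -- substitution μ through which σ factors.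
  module _ {σ μ η : Substitution} where

    Literals-[] : ∀ {t} → t [ σ ]ᵗ ≡ t [ μ ]ᵗ [ η ]ᵗ → Literals σ t → Literals η (t [ μ ]ᵗ)
    Literals-[] e [] = []
    Literals-[] e ((p , v) ∷ r) =
      let eₗ , eᵣ = ∷ᵗ-injective e in
      (TruthValue-[] μ p , subst TruthValue (proj₂ (-ᵗ-injective eₗ)) v) ∷ Literals-[] eᵣ r

    Satisfied-[] : ∀ {t} → t [ σ ]ᵗ ≡ t [ μ ]ᵗ [ η ]ᵗ → Satisfied σ t → Satisfied η (t [ μ ]ᵗ)
    Satisfied-[] e (here v≡p) =
      let eₚ , eᵥ = -ᵗ-injective (proj₁ (∷ᵗ-injective e)) in here (trans (sym eᵥ) (trans v≡p eₚ))
    Satisfied-[] e (there s) = there (Satisfied-[] (proj₂ (∷ᵗ-injective e)) s)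

    TrueClause-[] : ∀ {t} → t [ σ ]ᵗ ≡ t [ μ ]ᵗ [ η ]ᵗ → TrueClause σ t → TrueClause η (t [ μ ]ᵗ)
    TrueClause-[] e (ls , s) = Literals-[] e ls , Satisfied-[] e s

    TrueCNF-[] : ∀ {t} → t [ σ ]ᵗ ≡ t [ μ ]ᵗ [ η ]ᵗ → TrueCNF σ t → TrueCNF η (t [ μ ]ᵗ)
    TrueCNF-[] e []       = []
    TrueCNF-[] e (c ∷ cs) = let e₁ , e₂ = ∷ᵗ-injective e in TrueClause-[] e₁ c ∷ TrueCNF-[] e₂ cs

    TruthValues-[] : ∀ {t} → t [ σ ]ᵗ ≡ t [ μ ]ᵗ [ η ]ᵗ → TruthValues σ t → TruthValues η (t [ μ ]ᵗ)
    TruthValues-[] e []       = []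
    TruthValues-[] e (v ∷ vs) = let e₁ , e₂ = ∷ᵗ-injective e in subst TruthValue e₁ v ∷ TruthValues-[] e₂ vs

    private
      arg₁ : ∀ {n} {t u : Term} {ts us : Vec Term n} →
             _≡_ {A = Vec Term (suc n)} (t ∷ ts) (u ∷ us) → t ≡ u
      arg₁ = proj₁ ∘ Vec-∷-injective
      rest : ∀ {n} {t u : Term} {ts us : Vec Term n} →
             _≡_ {A = Vec Term (suc n)} (t ∷ ts) (u ∷ us) → ts ≡ us
      rest = proj₂ ∘ Vec-∷-injective

    Good-[] : ∀ {A} → A [ σ ]ᵃ ≡ A [ μ ]ᵃ [ η ]ᵃ → Good σ A → Good η (A [ μ ]ᵃ)
    Good-[] e (good-sat c v) =
      let e′ = ⟨⟩-injective e in good-sat (TrueCNF-[] (arg₁ e′) c) (TruthValues-[] (arg₁ (rest e′)) v)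
    Good-[] e (good-cnf c) = good-cnf (TrueCNF-[] (arg₁ (⟨⟩-injective e)) c)
    Good-[] e (good-cl c) = good-cl (TrueClause-[] (arg₁ (⟨⟩-injective e)) c)
    Good-[] e (good-eq s≡t) =
      let e′ = ⟨⟩-injective e in good-eq (trans (sym (arg₁ e′)) (trans s≡t (arg₁ (rest e′))))
    Good-[] e (good-cl3 c) =
      let e′ = ⟨⟩-injective e in
      good-cl3 (TrueClause-[] (cong₂ _∷ᵗ_ (cong₂ _-ᵗ_ (arg₁ (rest (rest e′))) (arg₁ (rest e′))) (arg₁ e′)) c)
    Good-[] e (good-cl5 c) =
      let e′ = ⟨⟩-injective e in
      good-cl5 (TrueClause-[] (cong₂ _∷ᵗ_ (cong₂ _-ᵗ_ (arg₁ (rest e′)) (arg₁ e′))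
        (cong₂ _∷ᵗ_ (cong₂ _-ᵗ_ (arg₁ (rest (rest (rest e′)))) (arg₁ (rest (rest e′))))
          (arg₁ (rest (rest (rest (rest e′))))))) c)
    Good-[] e (good-cl5a v c) =
      let e′ = ⟨⟩-injective e in
      good-cl5a (TruthValue-[] μ v) (TrueClause-[] (cong₂ _∷ᵗ_ (cong₂ _-ᵗ_ (arg₁ (rest e′)) (arg₁ e′))
        (cong₂ _∷ᵗ_ (cong₂ _-ᵗ_ (arg₁ (rest (rest (rest e′)))) (arg₁ (rest (rest e′))))
          (arg₁ (rest (rest (rest (rest e′))))))) c)
    Good-[] e (good-tflist v) = good-tflist (TruthValues-[] (arg₁ (⟨⟩-injective e)) v)
    Good-[] e (good-tf v) = good-tf (subst TruthValue (arg₁ (⟨⟩-injective e)) v)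

  -- Resolving a true atom with the selected program

  rules : List Clause
  rules = rule1 ∷ rule2 ∷ rule3 ∷ rule4 ∷ rule5 ∷ rule6 ∷ rule7 ∷ rule8
        ∷ rule9 ∷ rule10 ∷ rule11 ∷ rule12 ∷ rule13 ∷ rule14 ∷ rule15 ∷ []

  lookup∈P₃ : ∀ k → P₃ (lookup rules k)
  lookup∈P₃ k = ∈-lookup {xs = rules} k

  predOf : Atom → PredSym
  predOf (p ⟨ _ ⟩) = p

  rule∈Π₅ : ∀ {c} → P₃ c → predOf (head c) ≢ sat-cl5 → predOf (head c) ≢ sat-cl5a → program Π₅ c
  rule∈Π₅ c∈ ≢5 ≢5a = c∈ , λ where
    (inj₁ refl)               → ≢5 refl
    (inj₂ (inj₁ refl))        → ≢5 refl
    (inj₂ (inj₂ (inj₁ refl))) → ≢5a refl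
    (inj₂ (inj₂ (inj₂ refl))) → ≢5a refl

  program⊆P₃ : ∀ i {c} → program i c → P₃ c
  program⊆P₃ Π₁ refl = lookup∈P₃ (# 6)
  program⊆P₃ Π₂ refl = lookup∈P₃ (# 7)
  program⊆P₃ Π₃ refl = lookup∈P₃ (# 8)
  program⊆P₃ Π₄ refl = lookup∈P₃ (# 9)
  program⊆P₃ Π₅ c∈   = proj₁ c∈

  PreservesGood : Clause → Set
  PreservesGood c = ∀ {η τ} → Good η (head c [ τ ]ᵃ) → All (Good η) (body c [ τ ]ᑫ)

  -- The mgu is chosen by the tree and unknown here, so `body-good` covers every `μ` that factors
  -- the instance of `A` and makes `A` match the head. It cannot be stated for `σ` alone, as `Good`
  -- constrains polarities before instantiation.
  record Resolvable (σ : Substitution) (A : Atom) (i : ProgramName) : Set where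
    field
      clause    : Clause
      selected  : program i clause
      τ         : Substitution
      matches   : A [ σ ]ᵃ ≡ head clause [ τ ]ᵃ
      body-good : ∀ {μ η τ′} → A [ σ ]ᵃ ≡ A [ μ ]ᵃ [ η ]ᵃ → A [ μ ]ᵃ ≡ head clause [ τ′ ]ᵃ →
                  All (Good η) (body clause [ τ′ ]ᑫ)

  -- Variables of the rules are numbered from 0, so a list of terms gives their values in order.
  bind : List Term → Substitution
  bind []       x       = var x
  bind (t ∷ ts) 0       = t
  bind (t ∷ ts) (suc x) = bind ts x

  resolvable-Π₅ : ∀ {σ A} c τ → Good σ A → predOf A ≢ sat-cl5 → predOf A ≢ sat-cl5a → P₃ c →
                  A [ σ ]ᵃ ≡ head c [ τ ]ᵃ → PreservesGood c → Resolvable σ A Π₅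
  resolvable-Π₅ {A = p ⟨ ts ⟩} ((q ⟨ us ⟩) ← b) τ good ≢5 ≢5a c∈ m pg = record
    { clause    = (q ⟨ us ⟩) ← b
    ; selected  = rule∈Π₅ c∈ (subst (_≢ sat-cl5) p≡q ≢5) (subst (_≢ sat-cl5a) p≡q ≢5a)
    ; τ         = τ
    ; matches   = m
    ; body-good = λ {μ} e m′ → pg (subst (Good _) m′ (Good-[] {μ = μ} e good))
    }
    where
    p≡q : p ≡ q
    p≡q = cong predOf m

  -- Within `Π₅` the shape of the arguments determines the rule, except for a `tf`-atom, where the
  -- truth value under `σ` decides. The remaining cases are those where pruning could lose the
  -- branch.
  resolve : ∀ {σ A i} → Good σ A → ProgramFor A i → ¬ Delayed A → Resolvable σ A i
  resolve {σ} g@(good-sat {u} {l} _ _) (otherwise ≢5 ≢5a) _ =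
    resolvable-Π₅ rule11 (bind (u [ σ ]ᵗ ∷ l [ σ ]ᵗ ∷ [])) g ≢5 ≢5a
      (lookup∈P₃ (# 10)) refl
      λ { (good-sat c v) → good-cnf c ∷ good-tflist v ∷ [] }
  resolve g@(good-cnf []) (otherwise ≢5 ≢5a) _ =
    resolvable-Π₅ rule1 var g ≢5 ≢5a (lookup∈P₃ (# 0)) refl λ _ → []
  resolve {σ} g@(good-cnf (_∷_ {c} {cs} _ _)) (otherwise ≢5 ≢5a) _ =
    resolvable-Π₅ rule2 (bind (c [ σ ]ᵗ ∷ cs [ σ ]ᵗ ∷ [])) g ≢5 ≢5a (lookup∈P₃ (# 1)) refl
      λ { (good-cnf (c ∷ cs)) → good-cl c ∷ good-cnf cs ∷ [] }
  -- The empty clause is not satisfied.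
  resolve (good-cl ([] , ())) _ _
  resolve {σ} g@(good-cl (_∷_ {p} {v} {r} _ _ , _)) (otherwise ≢5 ≢5a) _ =
    resolvable-Π₅ rule3 (bind (p [ σ ]ᵗ ∷ v [ σ ]ᵗ ∷ r [ σ ]ᵗ ∷ [])) g ≢5 ≢5a (lookup∈P₃ (# 2)) refl
      λ { (good-cl c) → good-cl3 c ∷ [] }
  resolve {σ} g@(good-eq {s} {t} s≡t) (otherwise ≢5 ≢5a) _ =
    resolvable-Π₅ rule4 (bind (t [ σ ]ᵗ ∷ [])) g ≢5 ≢5a (lookup∈P₃ (# 3))
      (cong (λ s → eq ⟨ s ∷ t [ σ ]ᵗ ∷ [] ⟩) s≡t) λ _ → []
  resolve {σ} g@(good-cl3 {r} {v} {p} (_ ∷ [] , _)) (otherwise ≢5 ≢5a) _ =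
    resolvable-Π₅ rule5 (bind (v [ σ ]ᵗ ∷ p [ σ ]ᵗ ∷ [])) g ≢5 ≢5a
      (lookup∈P₃ (# 4)) refl
      λ { (good-cl3 (_ , here v≡p)) → good-eq v≡p ∷ [] ; (good-cl3 (_ , there ())) }
  resolve {σ} g@(good-cl3 {v = v₁} {p₁} (_ ∷ (_∷_ {p₂} {v₂} {r} _ _) , _)) (otherwise ≢5 ≢5a) _ =
    resolvable-Π₅ rule6 (bind (v₁ [ σ ]ᵗ ∷ p₁ [ σ ]ᵗ ∷ v₂ [ σ ]ᵗ ∷ p₂ [ σ ]ᵗ ∷ r [ σ ]ᵗ ∷ [])) g ≢5 ≢5a
      (lookup∈P₃ (# 5)) refl
      λ { (good-cl3 c) → good-cl5 c ∷ [] }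
  resolve {σ} g@(good-cl5 {v₁} {p₁} {v₂} {p₂} {r} ((_ , v₁-tv) ∷ _ , _)) (cl5-nonvar nonvar) _ = record
    { clause    = rule7
    ; selected  = refl
    ; τ         = bind (v₁ [ σ ]ᵗ ∷ p₁ [ σ ]ᵗ ∷ v₂ [ σ ]ᵗ ∷ p₂ [ σ ]ᵗ ∷ r [ σ ]ᵗ ∷ [])
    ; matches   = refl
    ; body-good = λ {μ} {τ′ = τ′} e m → case′ {τ′ = τ′} m (Good-[] {μ = μ} e g)
        (TruthValue-[] μ (TruthValue-nonvar v₁ nonvar v₁-tv))
    }
    where
    -- The arguments are generalised to variables so that the equation with the head can be matched
    -- by `refl`.
    case′ : ∀ {η τ′ v₁ p₁ v₂ p₂ r} → sat-cl5 ⟨ v₁ ∷ p₁ ∷ v₂ ∷ p₂ ∷ r ∷ [] ⟩ ≡ head rule7 [ τ′ ]ᵃ →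
            Good η (sat-cl5 ⟨ v₁ ∷ p₁ ∷ v₂ ∷ p₂ ∷ r ∷ [] ⟩) → TruthValue v₁ →
            All (Good η) (body rule7 [ τ′ ]ᑫ)
    case′ refl (good-cl5 c) v = good-cl5a v c ∷ []
  resolve (good-cl5 {v₂ = var y} _) cl5-var notDelayed = contradiction delayed notDelayed
  -- The first argument is a variable and the atom is not delayed, so `v₂` is a nonvariable; rule 8
  -- moves it to the first place.
  resolve {σ} g@(good-cl5 {v₁} {p₁} {v₂@(app _ _)} {p₂} {r} (_ ∷ ((_ , v₂-tv) ∷ _) , _)) cl5-var _ = record
    { clause    = rule8
    ; selected  = refl
    ; τ         = bind (v₁ [ σ ]ᵗ ∷ p₁ [ σ ]ᵗ ∷ v₂ [ σ ]ᵗ ∷ p₂ [ σ ]ᵗ ∷ r [ σ ]ᵗ ∷ [])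
    ; matches   = refl
    ; body-good = λ {μ} {τ′ = τ′} e m → case′ {τ′ = τ′} m (Good-[] {μ = μ} e g)
        (TruthValue-[] {v₂} μ (TruthValue-nonvar v₂ (λ _ ()) v₂-tv))
    }
    where
    swap : ∀ {η l₁ l₂ r} → Satisfied η (l₁ ∷ᵗ l₂ ∷ᵗ r) → Satisfied η (l₂ ∷ᵗ l₁ ∷ᵗ r)
    swap (here e)          = there (here e)
    swap (there (here e))  = here e
    swap (there (there s)) = there (there s)
    case′ : ∀ {η τ′ v₁ p₁ v₂ p₂ r} → sat-cl5 ⟨ v₁ ∷ p₁ ∷ v₂ ∷ p₂ ∷ r ∷ [] ⟩ ≡ head rule8 [ τ′ ]ᵃ →
            Good η (sat-cl5 ⟨ v₁ ∷ p₁ ∷ v₂ ∷ p₂ ∷ r ∷ [] ⟩) → TruthValue v₂ →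
            All (Good η) (body rule8 [ τ′ ]ᑫ)
    case′ refl (good-cl5 (l₁ ∷ (l₂ ∷ ls) , s)) v = good-cl5a v (l₂ ∷ (l₁ ∷ ls) , swap s) ∷ []
  -- Unifiable truth values coincide, so the first literal holds and committing to rule 9 is safe,
  -- whichever literal witnessed the satisfaction.
  resolve {σ} (good-cl5a {v₁} {p₁} {v₂} {p₂} {r} v₁-tv ((p₁-tv , _) ∷ _ , _)) (cl5a-unif (θ , unif)) _ = record
    { clause    = rule9
    ; selected  = refl
    ; τ         = bind (v₁ [ σ ]ᵗ ∷ p₁ [ σ ]ᵗ ∷ v₂ [ σ ]ᵗ ∷ p₂ [ σ ]ᵗ ∷ r [ σ ]ᵗ ∷ [])
    ; matches   = refl
    ; body-good = λ {μ} {τ′ = τ′} _ m → case′ {τ′ = τ′} m (cong (_[ μ ]ᵗ) (TruthValue-≡ ⟦ θ ⟧ v₁-tv p₁-tv unif))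
    }
    where
    case′ : ∀ {η τ′ v₁ p₁ v₂ p₂ r} → sat-cl5a ⟨ v₁ ∷ p₁ ∷ v₂ ∷ p₂ ∷ r ∷ [] ⟩ ≡ head rule9 [ τ′ ]ᵃ →
            v₁ ≡ p₁ → All (Good η) (body rule9 [ τ′ ]ᑫ)
    case′ {η} refl v≡p = good-eq (cong (_[ η ]ᵗ) v≡p) ∷ []
  -- If the first literal were satisfied, `v₁` and `p₁` would be the same constant, unified by the
  -- empty substitution.
  resolve {σ} (good-cl5a v₁-tv ((p₁-tv , _) ∷ _ , here v≡p)) (cl5a-nonunif nonunif) _ =
    contradiction ([] , cong (_[ var ]ᵗ) (TruthValue-≡ σ v₁-tv p₁-tv v≡p)) nonunif
  -- The satisfied literal is now among the others, and these form the clause of the `sat-cl3`-atom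
  -- in the body.
  resolve {σ} (good-cl5a {v₁} {p₁} {v₂} {p₂} {r} _ (_ ∷ ls , there s)) (cl5a-nonunif _) _ = record
    { clause    = rule10
    ; selected  = refl
    ; τ         = bind (v₁ [ σ ]ᵗ ∷ p₁ [ σ ]ᵗ ∷ v₂ [ σ ]ᵗ ∷ p₂ [ σ ]ᵗ ∷ r [ σ ]ᵗ ∷ [])
    ; matches   = refl
    ; body-good = λ {μ} {τ′ = τ′} e m → case′ {τ′ = τ′} m (Good-[] {μ = μ} (rest-eq (⟨⟩-injective e)) (good-cl3 (ls , s)))
    }
    where
    rest-eq : ∀ {v₁ p₁ v₂ p₂ r v₁′ p₁′ v₂′ p₂′ r′} →
              _≡_ {A = Vec Term 5} (v₁ ∷ p₁ ∷ v₂ ∷ p₂ ∷ r ∷ []) (v₁′ ∷ p₁′ ∷ v₂′ ∷ p₂′ ∷ r′ ∷ []) →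
              sat-cl3 ⟨ r ∷ v₂ ∷ p₂ ∷ [] ⟩ ≡ sat-cl3 ⟨ r′ ∷ v₂′ ∷ p₂′ ∷ [] ⟩
    rest-eq refl = refl
    case′ : ∀ {η τ′ v₁ p₁ v₂ p₂ r} → sat-cl5a ⟨ v₁ ∷ p₁ ∷ v₂ ∷ p₂ ∷ r ∷ [] ⟩ ≡ head rule10 [ τ′ ]ᵃ →
            Good η (sat-cl3 ⟨ r ∷ v₂ ∷ p₂ ∷ [] ⟩) → All (Good η) (body rule10 [ τ′ ]ᑫ)
    case′ refl good = good ∷ []
  resolve g@(good-tflist []) (otherwise ≢5 ≢5a) _ =
    resolvable-Π₅ rule12 var g ≢5 ≢5a
      (lookup∈P₃ (# 11)) refl λ _ → []
  resolve {σ} g@(good-tflist (_∷_ {v} {vs} _ _)) (otherwise ≢5 ≢5a) _ =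
    resolvable-Π₅ rule13 (bind (v [ σ ]ᵗ ∷ vs [ σ ]ᵗ ∷ [])) g ≢5 ≢5a
      (lookup∈P₃ (# 12)) refl
      λ { (good-tflist (v ∷ vs)) → good-tflist vs ∷ good-tf v ∷ [] }
  resolve {σ} g@(good-tf {v} (inj₁ v≡true)) (otherwise ≢5 ≢5a) _ =
    resolvable-Π₅ rule14 var g ≢5 ≢5a
      (lookup∈P₃ (# 13))
      (cong (λ t → tf ⟨ t ∷ [] ⟩) v≡true) λ _ → []
  resolve {σ} g@(good-tf {v} (inj₂ v≡false)) (otherwise ≢5 ≢5a) _ =
    resolvable-Π₅ rule15 var g ≢5 ≢5a
      (lookup∈P₃ (# 14))
      (cong (λ t → tf ⟨ t ∷ [] ⟩) v≡false) λ _ → []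
  resolve (good-cl5 _)    (otherwise ≢5 _)  _ = contradiction refl ≢5
  resolve (good-cl5a _ _) (otherwise _ ≢5a) _ = contradiction refl ≢5a

  -- Termination

  mutual
    -- A symbol counts 2 so that the list cell and the minus removed by rule 6 outweigh the 3 of
    -- `sat-cl5`, and the `nil` removed by rule 5 outweighs the 1 of `eq`.
    sizeᵗ : Term → ℕ
    sizeᵗ (var x)    = 0
    sizeᵗ (app f ts) = 2 + sizeᵗˢ ts

    sizeᵗˢ : ∀ {n} → Vec Term n → ℕ
    sizeᵗˢ []       = 0
    sizeᵗˢ (t ∷ ts) = sizeᵗ t + sizeᵗˢ ts

  -- Chosen so that in every rule the head is heavier than the body.
  predWeight : PredSym → ℕ
  predWeight sat      = 1
  predWeight eq       = 1
  predWeight sat-cl5a = 2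
  predWeight sat-cl5  = 3
  predWeight _        = 0

  weight : Atom → ℕ
  weight (p ⟨ ts ⟩) = predWeight p + sizeᵗˢ ts

  weightᑫ : Query → ℕ
  weightᑫ Q = sum (map weight Q)

  weightᑫ-++ : ∀ Q Q′ → weightᑫ (Q ++ Q′) ≡ weightᑫ Q + weightᑫ Q′
  weightᑫ-++ Q Q′ = trans (cong sum (map-++ weight Q Q′)) (sum-++ (map weight Q) (map weight Q′))

  weight-decreases : ∀ {c} τ → P₃ c → weightᑫ (body c [ τ ]ᑫ) < weight (head c [ τ ]ᵃ)
  weight-decreases τ c∈ = All.lookup {P = λ c → weightᑫ (body c [ τ ]ᑫ) < weight (head c [ τ ]ᵃ)}
    ( m≤m+n 1 1
    ∷ by (decreases₂ (s 0) (s 1))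
    ∷ by (decreases₃ (s 0) (s 1) (s 2))
    ∷ m≤m+n 1 _
    ∷ by (decreases₅ (s 0) (s 1))
    ∷ by (decreases₆ (s 0) (s 1) (s 2) (s 3) (s 4))
    ∷ by (decreases₇ (s 0) (s 1) (s 2) (s 3) (s 4))
    ∷ by (decreases₈ (s 0) (s 1) (s 2) (s 3) (s 4))
    ∷ by (decreases₉ (s 0) (s 1) (s 2) (s 3) (s 4))
    ∷ by (decreases₁₀ (s 0) (s 1) (s 2) (s 3) (s 4))
    ∷ by (decreases₁₁ (s 0) (s 1))
    ∷ m≤m+n 1 1
    ∷ by (decreases₁₃ (s 0) (s 1))
    ∷ m≤m+n 1 1
    ∷ m≤m+n 1 1
    ∷ []) c∈
    where
    s : ℕ → ℕ
    s x = sizeᵗ (τ x)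
    -- The ring solver proves equations only, so each strict inequality is given with its explicit
    -- slack `k`.
    by : ∀ {m n k} → suc m + k ≡ n → m < n
    by {m} {k = k} e = subst (m <_) e (s≤s (m≤m+n m k))
    decreases₂ : ∀ c cs → suc (c + 0 + (cs + 0 + 0)) + 1 ≡ 2 + (c + (cs + 0)) + 0
    decreases₂ = solve-∀
    decreases₃ : ∀ p v r → suc (r + (v + (p + 0)) + 0) + 3 ≡ 2 + (2 + (p + (v + 0)) + (r + 0)) + 0
    decreases₃ = solve-∀
    decreases₅ : ∀ v p → suc (1 + (v + (p + 0)) + 0) + 0 ≡ 2 + (v + (p + 0))
    decreases₅ = solve-∀
    decreases₆ : ∀ v₁ p₁ v₂ p₂ r → suc (3 + (v₁ + (p₁ + (v₂ + (p₂ + (r + 0))))) + 0) + 0 ≡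
                 2 + (2 + (p₂ + (v₂ + 0)) + (r + 0)) + (v₁ + (p₁ + 0))
    decreases₆ = solve-∀
    decreases₇ : ∀ v₁ p₁ v₂ p₂ r → suc (2 + (v₁ + (p₁ + (v₂ + (p₂ + (r + 0))))) + 0) + 0 ≡
                 3 + (v₁ + (p₁ + (v₂ + (p₂ + (r + 0)))))
    decreases₇ = solve-∀
    decreases₈ : ∀ v₁ p₁ v₂ p₂ r → suc (2 + (v₂ + (p₂ + (v₁ + (p₁ + (r + 0))))) + 0) + 0 ≡
                 3 + (v₁ + (p₁ + (v₂ + (p₂ + (r + 0)))))
    decreases₈ = solve-∀
    decreases₉ : ∀ v₁ p₁ v₂ p₂ r → suc (1 + (v₁ + (p₁ + 0)) + 0) + (v₂ + p₂ + r) ≡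
                 2 + (v₁ + (p₁ + (v₂ + (p₂ + (r + 0)))))
    decreases₉ = solve-∀
    decreases₁₀ : ∀ v₁ p₁ v₂ p₂ r → suc (r + (v₂ + (p₂ + 0)) + 0) + (1 + v₁ + p₁) ≡
                  2 + (v₁ + (p₁ + (v₂ + (p₂ + (r + 0)))))
    decreases₁₀ = solve-∀
    decreases₁₁ : ∀ cs vs → suc (cs + 0 + (vs + 0 + 0)) + 0 ≡ 1 + (cs + (vs + 0))
    decreases₁₁ = solve-∀
    decreases₁₃ : ∀ v vs → suc (vs + 0 + (v + 0 + 0)) + 1 ≡ 2 + (v + (vs + 0)) + 0
    decreases₁₃ = solve-∀

  -- No floundering

  -- The argument whose variables the atom will still bind to truth values; other atoms guarantee no
  -- bindings and get a ground term.
  coveringTerm : Atom → Term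
  coveringTerm (sat ⟨ _ ∷ l ∷ [] ⟩)  = l
  coveringTerm (tflist ⟨ l ∷ [] ⟩)   = l
  coveringTerm (tf ⟨ v ∷ [] ⟩)       = v
  coveringTerm _                     = []ᵗ

  coveringTerm-[] : ∀ {σ} A → coveringTerm (A [ σ ]ᵃ) ≡ coveringTerm A [ σ ]ᵗ
  coveringTerm-[] (sat-cnf ⟨ _ ⟩)        = refl
  coveringTerm-[] (sat-cl ⟨ _ ⟩)         = refl
  coveringTerm-[] (eq ⟨ _ ⟩)             = refl
  coveringTerm-[] (sat-cl3 ⟨ _ ⟩)        = refl
  coveringTerm-[] (sat-cl5 ⟨ _ ⟩)        = refl
  coveringTerm-[] (sat-cl5a ⟨ _ ⟩)       = refl
  coveringTerm-[] (sat ⟨ _ ∷ _ ∷ [] ⟩)   = refl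
  coveringTerm-[] (tflist ⟨ _ ∷ [] ⟩)    = refl
  coveringTerm-[] (tf ⟨ _ ∷ [] ⟩)        = refl
  coveringTerm-[] (other p ⟨ _ ⟩)        = refl

  Covered : Query → Set
  Covered Q = ∀ {A y} → A ∈ Q → y ∈ varsᵃ A → ∃[ B ] B ∈ Q × y ∈ varsᵗ (coveringTerm B)

  open DecMembership _≟_ using (_∈?_)

  -- Settled by evaluating a decision procedure on the finite list of rules.
  body-vars⊆head-vars : ∀ {c} → P₃ c → All (_∈ varsᵃ (head c)) (varsᑫ (body c))
  body-vars⊆head-vars = All.lookup {P = λ c → All (_∈ varsᵃ (head c)) (varsᑫ (body c))}
    (from-yes (All.all? (λ c → All.all? (_∈? varsᵃ (head c)) (varsᑫ (body c))) rules))

  -- Resolving a covering atom hands each of its variables on to an atom of the body. For the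
  -- `tf`-rules the covering term of the head is a constant, so nothing is left to hand on.
  head-covered : ∀ {c} → P₃ c →
                 All (λ x → Any (λ B → x ∈ varsᵗ (coveringTerm B)) (body c)) (varsᵗ (coveringTerm (head c)))
  head-covered = All.lookup
    {P = λ c → All (λ x → Any (λ B → x ∈ varsᵗ (coveringTerm B)) (body c)) (varsᵗ (coveringTerm (head c)))}
    (from-yes (All.all? (λ c → All.all? (λ x → Any.any? (λ B → x ∈? varsᵗ (coveringTerm B)) (body c))
                                 (varsᵗ (coveringTerm (head c)))) rules))

  delayed⇒covers-nothing : ∀ {A y} → Delayed A → y ∉ varsᵗ (coveringTerm A)
  delayed⇒covers-nothing delayed ()

  -- The first argument of a delayed atom is a variable, and the atom covering it is a `sat`-,
  -- `tflist`- or `tf`-atom, hence not delayed.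
  covered⇒¬all-delayed : ∀ {A As} → Covered (A ∷ As) → ¬ All Delayed (A ∷ As)
  covered⇒¬all-delayed cov all@(delayed ∷ _) with cov (here refl) (here refl)
  ... | B , B∈ , y∈ = delayed⇒covers-nothing (All.lookup all B∈) y∈

  selection : ∀ {𝓈} → ImplementsControl 𝓈 → ∀ Q → Covered Q →
              Q ≡ [] ⊎ ∃[ k ] ∃[ i ] Selects 𝓈 Q k i × ¬ Delayed (lookup Q k) × ProgramFor (lookup Q k) i
  selection     control []       cov = inj₁ refl
  selection {𝓈} control (A ∷ As) cov =
    inj₂ (proj₁ (𝓈 A As) , proj₂ (𝓈 A As) , refl , proj₂ (control A As) (covered⇒¬all-delayed cov))

  -- Invariants of one step along the branch

  module Step {𝓈 Q₀} (T : CsSLDTree 𝓈 Q₀) {d k c σ τ} (c∈P₃ : P₃ c)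
              (matches : lookup (end d) k [ ⟦ σ ⟧ ]ᵃ ≡ head c [ τ ]ᵃ)
              (lifted : LiftedStep T d k c σ τ) where
    open LiftedStep lifted

    private
      μ : Substitution
      μ = ⟦ mgu edge ⟧
      before after : Query
      before = take (toℕ k) (end d)
      after  = drop (suc (toℕ k)) (end d)

    ∈-resolvent⁻ : ∀ {B} → B ∈ resolvent edge →
                   (∃[ A ] A ∈ end d × B ≡ A [ μ ]ᵃ) ⊎ B ∈ body c [ τ′ ]ᑫ
    ∈-resolvent⁻ {B} B∈ with ∈-++⁻ (before [ μ ]ᑫ) (subst (B ∈_) resolves B∈)
    ... | inj₁ p = let A , A∈ , B≡ = ∈-map⁻ (_[ μ ]ᵃ) p in inj₁ (A , ∈-take⁻ {k = k} A∈ , B≡)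
    ... | inj₂ p with ∈-++⁻ (body c [ τ′ ]ᑫ) p
    ...   | inj₁ q = inj₂ q
    ...   | inj₂ q = let A , A∈ , B≡ = ∈-map⁻ (_[ μ ]ᵃ) q in inj₁ (A , ∈-drop⁻ {xs = end d} {k = k} A∈ , B≡)

    ∈-resolvent⁺ : ∀ {A} → A ∈ end d → A ≡ lookup (end d) k ⊎ A [ μ ]ᵃ ∈ resolvent edge
    ∈-resolvent⁺ A∈ with ∈-split {k = k} A∈
    ... | inj₁ p        = inj₂ (subst (_ ∈_) (sym resolves) (∈-++⁺ˡ (∈-map⁺ (_[ μ ]ᵃ) p)))
    ... | inj₂ (inj₁ p) = inj₁ p
    ... | inj₂ (inj₂ p) = inj₂ (subst (_ ∈_) (sym resolves)
      (∈-++⁺ʳ (before [ μ ]ᑫ) (∈-++⁺ʳ (body c [ τ′ ]ᑫ) (∈-map⁺ (_[ μ ]ᵃ) p))))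

    ∈-resolvent-body : ∀ {B} → B ∈ body c → B [ τ′ ]ᵃ ∈ resolvent edge
    ∈-resolvent-body B∈ = subst (_ ∈_) (sym resolves)
      (∈-++⁺ʳ (before [ μ ]ᑫ) (∈-++⁺ˡ (∈-map⁺ (_[ τ′ ]ᵃ) B∈)))

    instance-≡ : ∀ {A} → A ∈ end d → A [ ⟦ σ ⟧ ]ᵃ ≡ A [ μ ]ᵃ [ ⟦ η ⟧ ]ᵃ
    instance-≡ {A} A∈ =
      trans ([]ᵃ-cong A λ x∈ → agrees (end-vars⊆used d (varsᑫ⁺ A∈ x∈))) ([]ᵃ-⨟ A)

    resolvent-good : All (Good ⟦ σ ⟧) (end d) → All (Good ⟦ η ⟧) (body c [ τ′ ]ᑫ) →
                     All (Good ⟦ η ⟧) (resolvent edge)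
    resolvent-good good body-good = All.tabulate λ B∈ → case (∈-resolvent⁻ B∈)
      where
      case : ∀ {B} → (∃[ A ] A ∈ end d × B ≡ A [ μ ]ᵃ) ⊎ B ∈ body c [ τ′ ]ᑫ → Good ⟦ η ⟧ B
      case (inj₁ (A , A∈ , refl)) = Good-[] {μ = μ} (instance-≡ A∈) (All.lookup good A∈)
      case (inj₂ B∈)              = All.lookup body-good B∈

    instance-covered : Covered (end d) → ∀ {A y} → A ∈ end d → y ∈ varsᵃ (A [ μ ]ᵃ) →
                       ∃[ B ] B ∈ resolvent edge × y ∈ varsᵗ (coveringTerm B)
    instance-covered cov {A} {y} A∈ y∈ with varsᵃ-[]⁻ A y∈
    ... | x , x∈A , y∈μx with cov A∈ x∈A
    ...   | B , B∈ , x∈B with subst (λ t → y ∈ varsᵗ t) (sym (coveringTerm-[] B))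
                                    (varsᵗ-[]⁺ (coveringTerm B) x∈B y∈μx) | ∈-resolvent⁺ B∈
    ...     | y∈B | inj₂ Bμ∈ = B [ μ ]ᵃ , Bμ∈ , y∈B
    -- The covering atom is itself the selected one: `y` passes through the matched head to a
    -- covering atom of the body.
    ...     | y∈B | inj₁ refl
      with varsᵗ-[]⁻ (coveringTerm (head c))
             (subst (λ t → y ∈ varsᵗ t) (trans (cong coveringTerm head-eq) (coveringTerm-[] (head c))) y∈B)
    ...       | z , z∈ , y∈z with find (All.lookup (head-covered c∈P₃) z∈)
    ...         | C , C∈ , z∈C = C [ τ′ ]ᵃ , ∈-resolvent-body C∈ ,
      subst (λ t → y ∈ varsᵗ t) (sym (coveringTerm-[] C)) (varsᵗ-[]⁺ (coveringTerm C) z∈C y∈z)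

    -- Variables of the new body come from the head, hence from the instantiated selected atom, so
    -- both cases reduce to instances of old atoms.
    resolvent-covered : Covered (end d) → Covered (resolvent edge)
    resolvent-covered cov {B} {y} B∈ y∈ with ∈-resolvent⁻ B∈
    ... | inj₁ (A , A∈ , refl) = instance-covered cov A∈ y∈
    ... | inj₂ B∈body with varsᑫ-[]⁻ (body c) (varsᑫ⁺ B∈body y∈)
    ...   | z , z∈ , y∈z = instance-covered cov (∈-lookup {xs = end d} k)
      (subst (λ A → y ∈ varsᵃ A) (sym head-eq)
        (varsᵃ-[]⁺ (head c) (All.lookup (body-vars⊆head-vars c∈P₃) z∈) y∈z))

    instances-≡ : ∀ Q → (∀ {A} → A ∈ Q → A ∈ end d) → Q [ μ ]ᑫ [ ⟦ η ⟧ ]ᑫ ≡ Q [ ⟦ σ ⟧ ]ᑫ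
    instances-≡ []      Q⊆ = refl
    instances-≡ (A ∷ Q) Q⊆ = cong₂ _∷_ (sym (instance-≡ (Q⊆ (here refl)))) (instances-≡ Q (Q⊆ ∘ there))

    resolvent-instance : resolvent edge [ ⟦ η ⟧ ]ᑫ ≡
                         before [ ⟦ σ ⟧ ]ᑫ ++ body c [ τ ]ᑫ ++ after [ ⟦ σ ⟧ ]ᑫ
    resolvent-instance = begin
      resolvent edge [ ⟦ η ⟧ ]ᑫ
        ≡⟨ cong (_[ ⟦ η ⟧ ]ᑫ) resolves ⟩
      (before [ μ ]ᑫ ++ body c [ τ′ ]ᑫ ++ after [ μ ]ᑫ) [ ⟦ η ⟧ ]ᑫ
        ≡⟨ map-++ (_[ ⟦ η ⟧ ]ᵃ) (before [ μ ]ᑫ) _ ⟩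
      before [ μ ]ᑫ [ ⟦ η ⟧ ]ᑫ ++ (body c [ τ′ ]ᑫ ++ after [ μ ]ᑫ) [ ⟦ η ⟧ ]ᑫ
        ≡⟨ cong₂ _++_ (instances-≡ before (∈-take⁻ {k = k})) (map-++ (_[ ⟦ η ⟧ ]ᵃ) (body c [ τ′ ]ᑫ) _) ⟩
      before [ ⟦ σ ⟧ ]ᑫ ++ body c [ τ′ ]ᑫ [ ⟦ η ⟧ ]ᑫ ++ after [ μ ]ᑫ [ ⟦ η ⟧ ]ᑫ
        ≡⟨ cong (before [ ⟦ σ ⟧ ]ᑫ ++_)
                (cong₂ _++_ body-eq (instances-≡ after (∈-drop⁻ {xs = end d} {k = k}))) ⟩
      before [ ⟦ σ ⟧ ]ᑫ ++ body c [ τ ]ᑫ ++ after [ ⟦ σ ⟧ ]ᑫ ∎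
      where open ≡-Reasoning

    -- Under `η` the resolvent is the old instance with the selected atom replaced by a lighter
    -- body; the weights of the other atoms do not change.
    weight-resolvent : weightᑫ (resolvent edge [ ⟦ η ⟧ ]ᑫ) < weightᑫ (end d [ ⟦ σ ⟧ ]ᑫ)
    weight-resolvent = begin-strict
      weightᑫ (resolvent edge [ ⟦ η ⟧ ]ᑫ)
        ≡⟨ cong weightᑫ resolvent-instance ⟩
      weightᑫ (before [ ⟦ σ ⟧ ]ᑫ ++ body c [ τ ]ᑫ ++ after [ ⟦ σ ⟧ ]ᑫ)
        ≡⟨ weightᑫ-++ (before [ ⟦ σ ⟧ ]ᑫ) _ ⟩
      weightᑫ (before [ ⟦ σ ⟧ ]ᑫ) + weightᑫ (body c [ τ ]ᑫ ++ after [ ⟦ σ ⟧ ]ᑫ)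
        ≡⟨ cong (weightᑫ (before [ ⟦ σ ⟧ ]ᑫ) +_) (weightᑫ-++ (body c [ τ ]ᑫ) _) ⟩
      weightᑫ (before [ ⟦ σ ⟧ ]ᑫ) + (weightᑫ (body c [ τ ]ᑫ) + weightᑫ (after [ ⟦ σ ⟧ ]ᑫ))
        <⟨ +-monoʳ-< (weightᑫ (before [ ⟦ σ ⟧ ]ᑫ)) (+-monoˡ-< _ (weight-decreases τ c∈P₃)) ⟩
      weightᑫ (before [ ⟦ σ ⟧ ]ᑫ) + (weight (head c [ τ ]ᵃ) + weightᑫ (after [ ⟦ σ ⟧ ]ᑫ))
        ≡⟨ weightᑫ-++ (before [ ⟦ σ ⟧ ]ᑫ) _ ⟨
      weightᑫ (before [ ⟦ σ ⟧ ]ᑫ ++ head c [ τ ]ᵃ ∷ after [ ⟦ σ ⟧ ]ᑫ)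
        ≡⟨ cong (λ A → weightᑫ (before [ ⟦ σ ⟧ ]ᑫ ++ A ∷ after [ ⟦ σ ⟧ ]ᑫ)) matches ⟨
      weightᑫ (before [ ⟦ σ ⟧ ]ᑫ ++ (lookup (end d) k ∷ after) [ ⟦ σ ⟧ ]ᑫ)
        ≡⟨ cong weightᑫ (map-++ (_[ ⟦ σ ⟧ ]ᵃ) before _) ⟨
      weightᑫ ((before ++ lookup (end d) k ∷ after) [ ⟦ σ ⟧ ]ᑫ)
        ≡⟨ cong (λ Q → weightᑫ (Q [ ⟦ σ ⟧ ]ᑫ)) (take-lookup-drop (end d) k) ⟨
      weightᑫ (end d [ ⟦ σ ⟧ ]ᑫ) ∎
      where open ≤-Reasoning

    -- The instance of the root that is to be covered stays the same along the branch.
    partialAnswer-instance : partialAnswer d [ ⟦ σ ⟧ ]ᑫ ≡ partialAnswer (d ▷ edge) [ ⟦ η ⟧ ]ᑫ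
    partialAnswer-instance = begin
      partialAnswer d [ ⟦ σ ⟧ ]ᑫ
        ≡⟨ []ᑫ-cong (partialAnswer d) (agrees ∘ partialAnswer-vars⊆used d) ⟩
      partialAnswer d [ μ ⨟ ⟦ η ⟧ ]ᑫ
        ≡⟨ []ᑫ-⨟ (partialAnswer d) ⟩
      partialAnswer d [ μ ]ᑫ [ ⟦ η ⟧ ]ᑫ
        ≡⟨ cong (_[ ⟦ η ⟧ ]ᑫ) (partialAnswer-▷ d edge) ⟨
      partialAnswer (d ▷ edge) [ ⟦ η ⟧ ]ᑫ ∎
      where open ≡-Reasoning

  -- Following the branch to a success leaf

  module _ {𝓈 Q₀} (control : ImplementsControl 𝓈) (T : CsSLDTree 𝓈 Q₀) where

    -- Well-founded induction on the weight of the instantiated query, from an arbitrary node. At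
    -- the empty query the partial answer is an answer, and `σ` exhibits the instance.
    success : ∀ d σ → CsSLDTree.Node T d → Acc _<_ (weightᑫ (end d [ ⟦ σ ⟧ ]ᑫ)) →
              All (Good ⟦ σ ⟧) (end d) → Covered (end d) →
              ∃[ Q ] IsAnswerOf Q T × InstanceOfᑫ (partialAnswer d [ ⟦ σ ⟧ ]ᑫ) Q
    success d σ node (acc smaller) good cov with selection control (end d) cov
    ... | inj₁ end≡[] = partialAnswer d , (d , node , end≡[] , refl) , σ , refl
    ... | inj₂ (k , i , sel , notDelayed , prog)
      with resolve (All.lookup good (∈-lookup {xs = end d} k)) prog notDelayed
    ...   | r with lift T node sel (Resolvable.selected r) σ (Resolvable.τ r) (Resolvable.matches r)
    ...     | lifted =
      let open LiftedStep lifted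
          open Step T {σ = σ} (program⊆P₃ i (Resolvable.selected r)) (Resolvable.matches r) lifted
          body-good = Resolvable.body-good r (instance-≡ (∈-lookup {xs = end d} k)) head-eq
          Q , answer , inst = success (d ▷ edge) η (LiftedStep.node lifted) (smaller weight-resolvent)
                                (resolvent-good good body-good) (resolvent-covered cov)
      in Q , answer , subst (λ Q′ → InstanceOfᑫ Q′ Q) (sym partialAnswer-instance) inst

  -- The initial query

  -- The second component gives the values of single variables, from which the literals of the
  -- formula get theirs.
  listᵗ-TruthValues : ∀ {σ xs ss} → listᵗ (map var xs) [ σ ]ᵗ ≡ listᵗ ss → All TruthValue ss →
                      TruthValues σ (listᵗ (map var xs)) × (∀ {x} → x ∈ xs → TruthValue (σ x))
  listᵗ-TruthValues {xs = []}     _  _        = [] , λ ()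
  listᵗ-TruthValues {xs = x ∷ xs} {[]} () _
  listᵗ-TruthValues {xs = x ∷ xs} {s ∷ ss} e (v ∷ vs) =
    let e₁ , e₂ = ∷ᵗ-injective e
        ts , h  = listᵗ-TruthValues {xs = xs} e₂ vs
        σx      = subst TruthValue (sym e₁) v
    in σx ∷ ts , λ { (here refl) → σx ; (there x∈) → h x∈ }

  repClause-literals : ∀ {σ} C → (∀ {x} → x ∈ varsᵗ (repClause C) → TruthValue (σ x)) →
                       Literals σ (repClause C)
  repClause-literals []          h = []
  repClause-literals (pos x ∷ C) h = (inj₁ refl , h (here refl)) ∷ repClause-literals C (h ∘ there ∘ ∈-++⁺ˡ)
  repClause-literals (neg x ∷ C) h = (inj₂ refl , h (here refl)) ∷ repClause-literals C (h ∘ there ∘ ∈-++⁺ˡ)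

  repClause-satisfied : ∀ {σ} C {ps} → repClause C [ σ ]ᵗ ≡ listᵗ (map (uncurry (λ s s′ → s -ᵗ s′)) ps) →
                        Any (uncurry _≡_) ps → Satisfied σ (repClause C)
  repClause-satisfied []          {[]}    _ ()
  repClause-satisfied []          {_ ∷ _} () _
  repClause-satisfied (l ∷ C)     {[]}    _ ()
  repClause-satisfied (pos x ∷ C) {_ ∷ _} e (here s≡s′) =
    let eₚ , eᵥ = -ᵗ-injective (proj₁ (∷ᵗ-injective e)) in here (trans eᵥ (sym (trans eₚ s≡s′)))
  repClause-satisfied (neg x ∷ C) {_ ∷ _} e (here s≡s′) =
    let eₚ , eᵥ = -ᵗ-injective (proj₁ (∷ᵗ-injective e)) in here (trans eᵥ (sym (trans eₚ s≡s′)))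
  repClause-satisfied (l ∷ C)     {_ ∷ _} e (there any) =
    there (repClause-satisfied C (proj₂ (∷ᵗ-injective e)) any)

  repCNF-true : ∀ {σ} φ {ss} → (∀ {x} → x ∈ varsᵗ (repCNF φ) → TruthValue (σ x)) →
                repCNF φ [ σ ]ᵗ ≡ listᵗ ss → All L₁⁰ ss → TrueCNF σ (repCNF φ)
  repCNF-true []      h _ _ = []
  repCNF-true (C ∷ φ) {[]} h () _
  repCNF-true (C ∷ φ) {s ∷ ss} h e ((ps , s≡ , _ , _ , any) ∷ rest) =
    let e₁ , e₂ = ∷ᵗ-injective e in
      (repClause-literals C (h ∘ ∈-++⁺ˡ) , repClause-satisfied C (trans e₁ s≡) any)
    ∷ repCNF-true φ (h ∘ ∈-++⁺ʳ (varsᵗ (repClause C)) ∘ ∈-++⁺ˡ) e₂ rest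

  ∈-vars-listᵗ : ∀ {x xs} → x ∈ xs → x ∈ varsᵗ (listᵗ (map var xs))
  ∈-vars-listᵗ (here refl) = here refl
  ∈-vars-listᵗ (there x∈)  = there (∈-++⁺ˡ (∈-vars-listᵗ x∈))

  satQuery-covered : ∀ {u l} → (∀ {x} → x ∈ varsᵗ u → x ∈ varsᵗ l) → Covered (satQuery u l)
  satQuery-covered {u} {l} u⊆l (here refl) y∈ with ∈-++⁻ (varsᵗ u) y∈
  ... | inj₁ y∈u = _ , here refl , u⊆l y∈u
  ... | inj₂ y∈l with ∈-++⁻ (varsᵗ l) y∈l
  ...   | inj₁ p  = _ , here refl , p
  ...   | inj₂ ()

  satQuery-good : ∀ {σ φ xs} → (∀ {x} → x ∈ varsᵗ (repCNF φ) → x ∈ xs) →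
                  S₃⁰ ((sat ⟨ repCNF φ ∷ listᵗ (map var xs) ∷ [] ⟩) [ σ ]ᵃ) →
                  Good σ (sat ⟨ repCNF φ ∷ listᵗ (map var xs) ∷ [] ⟩)
  satQuery-good {φ = φ} {xs} u⊆xs (sat (ss , u≡ , clauses) (ts , l≡ , tvs)) =
    let values , xs-tv = listᵗ-TruthValues {xs = xs} l≡ tvs in
    good-sat (repCNF-true φ (xs-tv ∘ u⊆xs) u≡ clauses) values

mainTheorem6 : (𝒜 : Alphabet) → let open Language 𝒜 in
    (φ : CNF) (l : Term) → IsListOfVarsOf l (repCNF φ) →
    (𝓈 : CSelectionRule) → ImplementsControl 𝓈 →
    (T : CsSLDTree 𝓈 (satQuery (repCNF φ) l)) →
    CompleteWrt S₃⁰ T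
mainTheorem6 𝒜 φ l (xs , refl , _ , xs⇔vars) 𝓈 control T θ _ (holds ∷ []) =
  let open Language 𝒜
      vars⊆xs = λ {x} → Equivalence.from (xs⇔vars x)
      Q , answer , inst = success 𝒜 control T ε θ (CsSLDTree.root T) (<-wellFounded _)
                            (satQuery-good 𝒜 {φ = φ} vars⊆xs holds ∷ [])
                            (satQuery-covered 𝒜 (∈-vars-listᵗ 𝒜 ∘ vars⊆xs))
  -- At the root the composed mgus are the identity, so the partial answer is the initial query up
  -- to `[]ᑫ-var`.
  in Q , answer , subst (λ Q′ → InstanceOfᑫ (Q′ [ ⟦ θ ⟧ ]ᑫ) Q) ([]ᑫ-var 𝒜 (satQuery (repCNF φ) (listᵗ (map var xs)))) inst
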